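{- For $n\ge 1$ let $T_n$ be the number of complete non-ambiguous trees (CNATs) of size $n$, and for $\epsilon\in\{+1,-1\}$ let $T(n;\epsilon)$ be the number of CNATs $T$ of size $n$ with $\det M(T)=\epsilon$. If $n>1$ is odd, then $$T(n;+1)=T(n;-1)=\frac{T_n}{2}.$$ If $n=2p$ is even, then $$T(2p;+1)=\frac{T_{2p}+(-1)^pT_p}{2}\quad\text{and}\quad T(2p;-1)=\frac{T_{2p}-(-1)^pT_p}{2}.$$
   Context: A non-ambiguous tree (NAT) is a filling of an $m\times n$ rectangular grid in which each cell is dotted or not, such that: the top-left cell is dotted (the root); every dotted cell other than the root has either a dotted cell above it in the same column or a dotted cell to its left in the same row, but not both; and every row and every column contains at least one dotted cell. Each non-root dot $d$ has a parent: the nearest dot above it in its column, or the nearest dot to its left in its row (exactly one of these two kinds of dots exists). A complete non-ambiguous tree (CNAT) is a NAT in which every dot either has both a dot below it in its column and a dot to its right in its row (an internal dot), or neither (a leaf). The size of a CNAT is its number of leaves. Rows are labelled $1,2,\dots$ from top to bottom and columns from left to right. $M(T)$ is the $0/1$ matrix with entry $1$ exactly at the dotted cells of $T$; for a CNAT this matrix is square, since each row and each column contains exactly one leaf. -}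

module Defs where

open import Data.Bool using (Bool; true; false; _∧_; _∨_; not; _xor_; if_then_else_)
open import Data.Nat using (ℕ; zero; suc)
import Data.Nat as ℕ
open import Data.Fin using (Fin; zero; suc; toℕ; punchIn; _<?_)
open import Data.List using (List; []; _∷_; map; concatMap; foldr)
open import Data.Bool.ListAction using (any; all)
open import Data.Nat.ListAction using (sum)
open import Data.List using () renaming ([_] to [_]L)
open import Data.Vec.Functional using (Vector) renaming (_∷_ to _∷ᵥ_)
open import Data.Integer using (ℤ; +_; -_) renaming (_+_ to _+ℤ_; _*_ to _*ℤ_)
open import Relation.Nullary.Decidable using (⌊_⌋)

allFin : (n : ℕ) → List (Fin n)
allFin = Data.List.allFin

-- Grids: an n × n grid, g i j = true iff the cell in row i, column j
-- (rows top-to-bottom, columns left-to-right, 0-indexed) is dotted.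

Grid : ℕ → Set
Grid n = Fin n → Fin n → Bool

module _ {n : ℕ} (g : Grid n) where

  dotAbove : Fin n → Fin n → Bool
  dotAbove i j = any (λ i' → ⌊ i' <? i ⌋ ∧ g i' j) (allFin n)

  dotLeft : Fin n → Fin n → Bool
  dotLeft i j = any (λ j' → ⌊ j' <? j ⌋ ∧ g i j') (allFin n)

  dotBelow : Fin n → Fin n → Bool
  dotBelow i j = any (λ i' → ⌊ i <? i' ⌋ ∧ g i' j) (allFin n)

  dotRight : Fin n → Fin n → Bool
  dotRight i j = any (λ j' → ⌊ j <? j' ⌋ ∧ g i j') (allFin n)

  isRootCell : Fin n → Fin n → Bool
  isRootCell zero zero = true
  isRootCell _    _    = false

  rootDotted : Bool
  rootDotted = any (λ i → any (λ j → isRootCell i j ∧ g i j) (allFin n)) (allFin n)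

  parentCondition : Bool
  parentCondition =
    all (λ i → all (λ j →
      not (g i j) ∨ isRootCell i j ∨ (dotAbove i j xor dotLeft i j)) (allFin n)) (allFin n)

  rowsNonEmpty : Bool
  rowsNonEmpty = all (λ i → any (λ j → g i j) (allFin n)) (allFin n)

  colsNonEmpty : Bool
  colsNonEmpty = all (λ j → any (λ i → g i j) (allFin n)) (allFin n)

  isNAT : Bool
  isNAT = rootDotted ∧ parentCondition ∧ rowsNonEmpty ∧ colsNonEmpty

  isInternal isLeaf : Fin n → Fin n → Bool
  isInternal i j = g i j ∧ dotBelow i j ∧ dotRight i j
  isLeaf     i j = g i j ∧ not (dotBelow i j) ∧ not (dotRight i j)

  isComplete : Bool
  isComplete = all (λ i → all (λ j →
      not (g i j) ∨ isInternal i j ∨ isLeaf i j) (allFin n)) (allFin n)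

  isCNAT : Bool
  isCNAT = isNAT ∧ isComplete

  countTrue : List Bool → ℕ
  countTrue bs = sum (map (λ b → if b then 1 else 0) bs)

  numLeaves : ℕ
  numLeaves = countTrue (concatMap (λ i → map (λ j → isLeaf i j) (allFin n)) (allFin n))

  M : Fin n → Fin n → ℤ
  M i j = if g i j then + 1 else + 0

sign : ℕ → ℤ
sign zero = + 1
sign (suc k) = - sign k

det : (n : ℕ) → (Fin n → Fin n → ℤ) → ℤ
det zero    A = + 1
det (suc n) A =
  foldr _+ℤ_ (+ 0)
    (map (λ j → sign (toℕ j) *ℤ (A zero j *ℤ det n (λ i k → A (suc i) (punchIn j k))))
         (allFin (suc n)))

allFuns : {A : Set} → List A → (k : ℕ) → List (Fin k → A)
allFuns xs zero    = [ (λ ()) ]L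
allFuns xs (suc k) = concatMap (λ x → map (λ f → x ∷ᵥ f) (allFuns xs k)) xs

allGrids : (n : ℕ) → List (Grid n)
allGrids n = allFuns (allFuns (true ∷ false ∷ []) n) n

count : {A : Set} → (A → Bool) → List A → ℕ
count p xs = sum (map (λ x → if p x then 1 else 0) xs)

-- A CNAT of size n (n leaves) necessarily lives in an n × n grid,
-- since every row and every column contains exactly one leaf.
isCNATOfSize : (n : ℕ) → Grid n → Bool
isCNATOfSize n g = isCNAT g ∧ ⌊ numLeaves g ℕ.≟ n ⌋

Tcount : ℕ → ℕ
Tcount n = count (isCNATOfSize n) (allGrids n)

Tdet : ℕ → ℤ → ℕ
Tdet n ε = count (λ g → isCNATOfSize n g ∧ ⌊ det n (M g) Data.Integer.≟ ε ⌋) (allGrids n)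

{-# OPTIONS --safe #-}

-- Deleting the root of a CNAT with m+1 rows and n+1 columns splits it into a left subtree (hanging
-- from the first column) and a right subtree (hanging from the first row): each other row and each
-- other column belongs to exactly one of them, and conversely any two CNATs of fitting sizes can be
-- put back together along a shuffle σ of the m rows and a shuffle τ of the n columns. After sorting
-- the lines by subtree the dot matrix becomes block triangular, so its determinant is the product of
-- the two smaller determinants and of the signs of the two line permutations; in particular it is ±1.
-- Hence W(n) = T(n;+1) − T(n;−1) satisfies the recursion of T_n with binomial coefficients replaced
-- by signed sums over shuffles. Exchanging the first two letters of a shuffle, when they differ,
-- cancels all shuffles except those made of doubled letters (and, in odd length, one last letter).
-- What remains of the recursion forces W(n) = 0 for odd n > 1 and W(2p) = (−1)^p T_p.

module Submission where

open import Defs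
open import Data.Bool using (Bool; true; false; _∧_; _∨_; not; _xor_; if_then_else_)
open import Data.Nat as ℕ using (ℕ; zero; suc; _+_; _*_; _≤_; _<_; z≤n; s≤s)
import Data.Nat.Properties as ℕₚ
open import Data.Integer as ℤ using (ℤ; +_; -_; -[1+_]) renaming (_+_ to _+ℤ_; _-_ to _-ℤ_; _*_ to _*ℤ_)
import Data.Integer.Properties as ℤₚ
open import Data.Fin as Fin using (Fin; zero; suc; toℕ; punchIn)
import Data.Fin.Properties as Finₚ
open import Data.List as List using (List; []; _∷_; _++_; concatMap)
open import Data.Vec as Vec using (Vec; []; _∷_; lookup; replicate)
import Data.Vec.Properties as Vecₚ
open import Data.Product using (∃; ∃₂; _×_; _,_; proj₁; proj₂)
open import Data.Sum using (_⊎_; inj₁; inj₂)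
open import Data.Empty using (⊥; ⊥-elim)
open import Function using (_∘_; flip; id; case_of_)
open import Relation.Binary.Definitions using (tri<; tri≈; tri>)
open import Relation.Nullary using (¬_; Dec; yes; no; does)
open import Relation.Binary.PropositionalEquality hiding (J)
open import Data.Integer.Tactic.RingSolver using (solve-∀)
open import Induction.WellFounded using (Acc; acc)
open import Data.Fin.Induction using (<-wellFounded; >-wellFounded)
open import Data.Bool.Properties using () renaming (_≟_ to _≟ᵇ_)
open import Data.Fin.Properties using (any?; all?; _<?_)
open import Relation.Nullary.Decidable using (⌊_⌋; map′; _×-dec_; _⊎-dec_; _→-dec_; ¬?)
open import Data.Bool.ListAction using (any; all)
open import Data.Vec.Functional using () renaming (_∷_ to _∷ᵥ_)

-- Sums and shuffles

-- The recursion has to run over rectangular grids. The first column belongs to the left subtree and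
-- the first row to the right one, so with `a + b` remaining rows and `c + d` remaining columns the
-- two subtrees occupy an `a` by `c + 1` and a `b + 1` by `d` grid. The two shuffles vary
-- independently and mostly give shapes that are not square, whose totals vanish. This is what
-- drives the final evaluation: after the cancellation the parities of all line numbers are known,
-- and a term with an even and an odd side is zero. For odd size every term has such a factor. For
-- even size there remain pairs of odd subtrees, one of which is larger than a single cell once the
-- size exceeds 2, and pairs of even subtrees. The latter all carry one sign that depends on the
-- total size only, so they add up to the unsigned recursion at half size.
--
-- No bijection between trees and pairs of trees is built. For each tree the indicators of the
-- admissible pairs of shuffles add up to 1; inserting this 1 and exchanging sums gives the
-- recursion.

sumL : {X : Set} → List X → (X → ℤ) → ℤ
sumL []       f = + 0
sumL (x ∷ xs) f = f x +ℤ sumL xs f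

module _ {X : Set} where

  sumL-cong : (xs : List X) {f g : X → ℤ} → (∀ x → f x ≡ g x) → sumL xs f ≡ sumL xs g
  sumL-cong []       e = refl
  sumL-cong (x ∷ xs) e = cong₂ _+ℤ_ (e x) (sumL-cong xs e)

  sumL-zero : (xs : List X) {f : X → ℤ} → (∀ x → f x ≡ + 0) → sumL xs f ≡ + 0
  sumL-zero []       e = refl
  sumL-zero (x ∷ xs) e = cong₂ _+ℤ_ (e x) (sumL-zero xs e)

  sumL-+ : (xs : List X) (f g : X → ℤ) → sumL xs (λ x → f x +ℤ g x) ≡ sumL xs f +ℤ sumL xs g
  sumL-+ []       f g = refl
  sumL-+ (x ∷ xs) f g rewrite sumL-+ xs f g = interchange (f x) (g x) (sumL xs f) (sumL xs g)
    where
    interchange : ∀ a b c d → a +ℤ b +ℤ (c +ℤ d) ≡ a +ℤ c +ℤ (b +ℤ d)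
    interchange = solve-∀

  sumL-*ˡ : (xs : List X) (c : ℤ) (f : X → ℤ) → sumL xs (λ x → c *ℤ f x) ≡ c *ℤ sumL xs f
  sumL-*ˡ []       c f = sym (ℤₚ.*-zeroʳ c)
  sumL-*ˡ (x ∷ xs) c f rewrite sumL-*ˡ xs c f = sym (ℤₚ.*-distribˡ-+ c (f x) (sumL xs f))

  sumL-*ʳ : (xs : List X) (c : ℤ) (f : X → ℤ) → sumL xs (λ x → f x *ℤ c) ≡ sumL xs f *ℤ c
  sumL-*ʳ []       c f = refl
  sumL-*ʳ (x ∷ xs) c f rewrite sumL-*ʳ xs c f = sym (ℤₚ.*-distribʳ-+ c (f x) (sumL xs f))

  sumL-++ : (xs ys : List X) (f : X → ℤ) → sumL (xs ++ ys) f ≡ sumL xs f +ℤ sumL ys f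
  sumL-++ []       ys f = sym (ℤₚ.+-identityˡ _)
  sumL-++ (x ∷ xs) ys f rewrite sumL-++ xs ys f = sym (ℤₚ.+-assoc (f x) _ _)

module _ {X Y : Set} where

  sumL-map : (h : X → Y) (xs : List X) (f : Y → ℤ) → sumL (List.map h xs) f ≡ sumL xs (f ∘ h)
  sumL-map h []       f = refl
  sumL-map h (x ∷ xs) f = cong (f (h x) +ℤ_) (sumL-map h xs f)

  sumL-concatMap : (h : X → List Y) (xs : List X) (f : Y → ℤ) →
    sumL (concatMap h xs) f ≡ sumL xs (λ x → sumL (h x) f)
  sumL-concatMap h []       f = refl
  sumL-concatMap h (x ∷ xs) f =
    trans (sumL-++ (h x) (concatMap h xs) f) (cong (sumL (h x) f +ℤ_) (sumL-concatMap h xs f))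

  sumL-swap : (xs : List X) (ys : List Y) (f : X → Y → ℤ) →
    sumL xs (λ x → sumL ys (f x)) ≡ sumL ys (λ y → sumL xs (λ x → f x y))
  sumL-swap []       ys f = sym (sumL-zero ys (λ _ → refl))
  sumL-swap (x ∷ xs) ys f rewrite sumL-swap xs ys f = sym (sumL-+ ys (f x) _)

  sumL-product : (xs : List X) (ys : List Y) (c : ℤ) (f : X → ℤ) (g : Y → ℤ) →
    sumL xs (λ x → sumL ys (λ y → c *ℤ (f x *ℤ g y))) ≡ c *ℤ (sumL xs f *ℤ sumL ys g)
  sumL-product xs ys c f g = begin
    sumL xs (λ x → sumL ys (λ y → c *ℤ (f x *ℤ g y)))
      ≡⟨ sumL-cong xs (λ x → trans (sumL-*ˡ ys c _) (cong (c *ℤ_) (sumL-*ˡ ys (f x) g))) ⟩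
    sumL xs (λ x → c *ℤ (f x *ℤ sumL ys g))
      ≡⟨ trans (sumL-*ˡ xs c _) (cong (c *ℤ_) (sumL-*ʳ xs (sumL ys g) f)) ⟩
    c *ℤ (sumL xs f *ℤ sumL ys g) ∎
    where open ≡-Reasoning

sumL-tabulate : ∀ n {X : Set} (h : Fin n → X) (f : X → ℤ) →
  sumL (List.tabulate h) f ≡ sumL (allFin n) (f ∘ h)
sumL-tabulate zero    h f = refl
sumL-tabulate (suc n) h f = cong (f (h zero) +ℤ_)
  (trans (sumL-tabulate n (h ∘ suc) f) (sym (sumL-tabulate n suc (f ∘ h))))

sumL-allFin-suc : ∀ n (f : Fin (suc n) → ℤ) →
  sumL (allFin (suc n)) f ≡ f zero +ℤ sumL (allFin n) (f ∘ suc)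
sumL-allFin-suc n f = cong (f zero +ℤ_) (sumL-tabulate n suc f)

⟦_⟧ : Bool → ℤ
⟦ true ⟧  = + 1
⟦ false ⟧ = + 0

⟦⟧-∧ : ∀ b c → ⟦ b ∧ c ⟧ ≡ ⟦ b ⟧ *ℤ ⟦ c ⟧
⟦⟧-∧ true  true  = refl
⟦⟧-∧ true  false = refl
⟦⟧-∧ false true  = refl
⟦⟧-∧ false false = refl

⟦⟧*-cong : ∀ b {x y} → (b ≡ true → x ≡ y) → ⟦ b ⟧ *ℤ x ≡ ⟦ b ⟧ *ℤ y
⟦⟧*-cong true  e = cong (+ 1 *ℤ_) (e refl)
⟦⟧*-cong false e = refl

bits : List Bool
bits = true ∷ false ∷ []

-- Vectors replace functions so that grids can be woven together and taken apart by pattern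
-- matching, without function extensionality; `sumL-allGrids` makes the link to `allGrids`.
vecs : {X : Set} → List X → (k : ℕ) → List (Vec X k)
vecs xs zero    = [] ∷ []
vecs xs (suc k) = concatMap (λ x → List.map (x ∷_) (vecs xs k)) xs

grids : (m n : ℕ) → List (Vec (Vec Bool n) m)
grids m n = vecs (vecs bits n) m

sumL-vecs-suc : {X : Set} (xs : List X) (k : ℕ) (f : Vec X (suc k) → ℤ) →
  sumL (vecs xs (suc k)) f ≡ sumL xs (λ x → sumL (vecs xs k) (λ v → f (x ∷ v)))
sumL-vecs-suc xs k f = trans (sumL-concatMap _ xs f)
  (sumL-cong xs (λ x → sumL-map (x ∷_) (vecs xs k) f))

-- Words with `a` letters l and `b` letters r. The length is an index of its own, so that matching
-- never has to unify with `a + b`; `shuf-size` recovers the equation.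
data Shuf : ℕ → ℕ → ℕ → Set where
  []  : Shuf 0 0 0
  l∷_ : ∀ {a b n} → Shuf a b n → Shuf (suc a) b (suc n)
  r∷_ : ∀ {a b n} → Shuf a b n → Shuf a (suc b) (suc n)

infixr 5 l∷_ r∷_

variable
  a b c d m n : ℕ
  X : Set

-- Exchanging the letters reduces facts about right positions to facts about left ones.
swap : Shuf a b n → Shuf b a n
swap []     = []
swap (l∷ σ) = r∷ swap σ
swap (r∷ σ) = l∷ swap σ

swap-swap : (σ : Shuf a b n) → swap (swap σ) ≡ σ
swap-swap []     = refl
swap-swap (l∷ σ) = cong l∷_ (swap-swap σ)
swap-swap (r∷ σ) = cong r∷_ (swap-swap σ)

inl : Shuf a b n → Fin a → Fin n
inl (l∷ σ) zero    = zero
inl (l∷ σ) (suc i) = suc (inl σ i)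
inl (r∷ σ) i       = suc (inl σ i)

inr : Shuf a b n → Fin b → Fin n
inr σ = inl (swap σ)

side : Shuf a b n → Fin n → Bool
side (l∷ σ) zero    = false
side (l∷ σ) (suc i) = side σ i
side (r∷ σ) zero    = true
side (r∷ σ) (suc i) = side σ i

side-swap : (σ : Shuf a b n) (i : Fin n) → side (swap σ) i ≡ not (side σ i)
side-swap (l∷ σ) zero    = refl
side-swap (l∷ σ) (suc i) = side-swap σ i
side-swap (r∷ σ) zero    = refl
side-swap (r∷ σ) (suc i) = side-swap σ i

side-inl : (σ : Shuf a b n) (x : Fin a) → side σ (inl σ x) ≡ false
side-inl (l∷ σ) zero    = refl
side-inl (l∷ σ) (suc x) = side-inl σ x
side-inl (r∷ σ) x       = side-inl σ x

inl-surj : (σ : Shuf a b n) (i : Fin n) → side σ i ≡ false → ∃ λ x → i ≡ inl σ x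
inl-surj (l∷ σ) zero    e = zero , refl
inl-surj (l∷ σ) (suc i) e with inl-surj σ i e
... | x , p = suc x , cong suc p
inl-surj (r∷ σ) (suc i) e with inl-surj σ i e
... | x , p = x , cong suc p

not-true : ∀ {x} → x ≡ true → not x ≡ false
not-true refl = refl

not-false : ∀ {x} → not x ≡ false → x ≡ true
not-false {true} refl = refl

side-inr : (σ : Shuf a b n) (y : Fin b) → side σ (inr σ y) ≡ true
side-inr σ y = not-false (trans (sym (side-swap σ (inr σ y))) (side-inl (swap σ) y))

inr-surj : (σ : Shuf a b n) (i : Fin n) → side σ i ≡ true → ∃ λ y → i ≡ inr σ y
inr-surj σ i e = inl-surj (swap σ) i (trans (side-swap σ i) (not-true e))

data Split (σ : Shuf a b n) : Fin n → Set where
  isL : (x : Fin a) → Split σ (inl σ x)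
  isR : (y : Fin b) → Split σ (inr σ y)

split : (σ : Shuf a b n) (i : Fin n) → Split σ i
split σ i with side σ i in e
... | false with inl-surj σ i e
...   | x , refl = isL x
split σ i | true with inr-surj σ i e
...   | y , refl = isR y

inl-mono : (σ : Shuf a b n) {x y : Fin a} → x Fin.< y → inl σ x Fin.< inl σ y
inl-mono (l∷ σ) {zero}  {suc y} _       = s≤s z≤n
inl-mono (l∷ σ) {suc x} {suc y} (s≤s p) = s≤s (inl-mono σ p)
inl-mono (r∷ σ)                 p       = s≤s (inl-mono σ p)

shuf-size : Shuf a b n → a + b ≡ n
shuf-size []                   = refl
shuf-size (l∷ σ)               = cong suc (shuf-size σ)
shuf-size {a = a} (r∷_ {b = b} σ) = trans (ℕₚ.+-suc a b) (cong suc (shuf-size σ))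

weave : Shuf a b n → Vec X a → Vec X b → Vec X n
weave []     xs       ys       = []
weave (l∷ σ) (x ∷ xs) ys       = x ∷ weave σ xs ys
weave (r∷ σ) xs       (y ∷ ys) = y ∷ weave σ xs ys

weave-swap : (σ : Shuf a b n) (xs : Vec X a) (ys : Vec X b) → weave (swap σ) ys xs ≡ weave σ xs ys
weave-swap []     []       []       = refl
weave-swap (l∷ σ) (x ∷ xs) ys       = cong (x ∷_) (weave-swap σ xs ys)
weave-swap (r∷ σ) xs       (y ∷ ys) = cong (y ∷_) (weave-swap σ xs ys)

lookup-weaveˡ : (σ : Shuf a b n) (xs : Vec X a) (ys : Vec X b) (x : Fin a) →
  lookup (weave σ xs ys) (inl σ x) ≡ lookup xs x
lookup-weaveˡ (l∷ σ) (x ∷ xs) ys       zero    = refl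
lookup-weaveˡ (l∷ σ) (x ∷ xs) ys       (suc i) = lookup-weaveˡ σ xs ys i
lookup-weaveˡ (r∷ σ) xs       (y ∷ ys) i       = lookup-weaveˡ σ xs ys i

lookup-weaveʳ : (σ : Shuf a b n) (xs : Vec X a) (ys : Vec X b) (y : Fin b) →
  lookup (weave σ xs ys) (inr σ y) ≡ lookup ys y
lookup-weaveʳ σ xs ys y rewrite sym (weave-swap σ xs ys) = lookup-weaveˡ (swap σ) ys xs y

AnyShuf : ℕ → Set
AnyShuf n = ∃₂ λ a b → Shuf a b n

shufs : (n : ℕ) → List (AnyShuf n)
shufs zero    = (0 , 0 , []) ∷ []
shufs (suc n) = List.map (λ (a , b , σ) → suc a , b , l∷ σ) (shufs n)
             ++ List.map (λ (a , b , σ) → a , suc b , r∷ σ) (shufs n)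

sumL-shufs-suc : ∀ n (F : AnyShuf (suc n) → ℤ) → sumL (shufs (suc n)) F
  ≡ sumL (shufs n) (λ (a , b , σ) → F (suc a , b , l∷ σ))
  +ℤ sumL (shufs n) (λ (a , b , σ) → F (a , suc b , r∷ σ))
sumL-shufs-suc n F = trans (sumL-++ (List.map _ (shufs n)) _ F)
  (cong₂ _+ℤ_ (sumL-map _ (shufs n) F) (sumL-map _ (shufs n) F))

-- Complete non-ambiguous trees and their splitting at the root

module _ (g : Fin m → Fin n → Bool) where

  Left Right Above Below : Fin m → Fin n → Set
  Left  i j = ∃ λ j' → j' Fin.< j × g i j' ≡ true
  Right i j = ∃ λ j' → j Fin.< j' × g i j' ≡ true
  Above i j = ∃ λ i' → i' Fin.< i × g i' j ≡ true
  Below i j = ∃ λ i' → i Fin.< i' × g i' j ≡ true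

  Root : Fin m → Fin n → Set
  Root i j = toℕ i ≡ 0 × toℕ j ≡ 0

  -- Rows and columns may differ in number, as the recursion meets all shapes; squareness is a
  -- theorem, `IsCNAT-square`. The last two fields express completeness: no dot has a child in one
  -- direction only.
  record IsCNAT : Set where
    field
      root       : ∃₂ λ i j → Root i j × g i j ≡ true
      parent     : ∀ i j → g i j ≡ true → Root i j ⊎ (Above i j ⊎ Left i j)
      ¬both      : ∀ i j → g i j ≡ true → Above i j → Left i j → ⊥
      row        : ∀ i → ∃ λ j → g i j ≡ true
      col        : ∀ j → ∃ λ i → g i j ≡ true
      belowRight : ∀ i j → g i j ≡ true → Below i j → Right i j
      rightBelow : ∀ i j → g i j ≡ true → Right i j → Below i j

-- Since the definition is symmetric under transposition, one lemma about the left subtree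
-- also serves for the right one.
transpose : {g : Fin m → Fin n → Bool} → IsCNAT g → IsCNAT (flip g)
transpose C = record
  { root       = let i , j , (p , q) , e = root in j , i , (q , p) , e
  ; parent     = λ j i e → swap⊎ (parent i j e)
  ; ¬both      = λ j i e a l → ¬both i j e l a
  ; row        = col
  ; col        = row
  ; belowRight = λ j i → rightBelow i j
  ; rightBelow = λ j i → belowRight i j
  }
  where
  open IsCNAT C
  swap⊎ : ∀ {P Q A L : Set} → (P × Q) ⊎ (A ⊎ L) → (Q × P) ⊎ (L ⊎ A)
  swap⊎ (inj₁ (p , q))  = inj₁ (q , p)
  swap⊎ (inj₂ (inj₁ a)) = inj₂ (inj₂ a)
  swap⊎ (inj₂ (inj₂ l)) = inj₂ (inj₁ l)

IsCNAT-ext : {g h : Fin m → Fin n → Bool} → (∀ i j → g i j ≡ h i j) → IsCNAT g → IsCNAT h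
IsCNAT-ext {g = g} {h} e C = record
  { root       = let i , j , r , p = root in i , j , r , to p
  ; parent     = λ i j p → par (parent i j (from p))
  ; ¬both      = λ i j p (i' , u , q) (j' , v , r) →
                   ¬both i j (from p) (i' , u , from q) (j' , v , from r)
  ; row        = λ i → let j , p = row i in j , to p
  ; col        = λ j → let i , p = col j in i , to p
  ; belowRight = λ i j p (i' , u , q) →
                   let j' , v , r = belowRight i j (from p) (i' , u , from q) in j' , v , to r
  ; rightBelow = λ i j p (i' , u , q) →
                   let j' , v , r = rightBelow i j (from p) (i' , u , from q) in j' , v , to r
  }
  where
  open IsCNAT C
  to : ∀ {i j} → g i j ≡ true → h i j ≡ true
  to {i} {j} p = trans (sym (e i j)) p
  from : ∀ {i j} → h i j ≡ true → g i j ≡ true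
  from {i} {j} p = trans (e i j) p
  par : ∀ {i j} → Root g i j ⊎ (Above g i j ⊎ Left g i j) → Root h i j ⊎ (Above h i j ⊎ Left h i j)
  par (inj₁ r)                  = inj₁ r
  par (inj₂ (inj₁ (i' , u , p))) = inj₂ (inj₁ (i' , u , to p))
  par (inj₂ (inj₂ (j' , u , p))) = inj₂ (inj₂ (j' , u , to p))

-- The rows f and columns h carry a subtree hanging below the root: they contain the first column
-- but not the first row, and no dot other than the root joins them to the remaining lines.
record Block (g : Fin m → Fin n → Bool) (f : Fin a → Fin m) (h : Fin c → Fin n) : Set where
  field
    f-mono     : ∀ {x y} → x Fin.< y → f x Fin.< f y
    h-mono     : ∀ {x y} → x Fin.< y → h x Fin.< h y
    f-pos      : ∀ x → 0 < toℕ (f x)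
    first      : ∃ λ y → toℕ y ≡ 0 × toℕ (h y) ≡ 0
    row-closed : ∀ {x j} → g (f x) j ≡ true → ∃ λ y → j ≡ h y
    col-closed : ∀ {i y} → g i (h y) ≡ true → Root g i (h y) ⊎ ∃ λ x → i ≡ f x

least : (p : Fin n → Bool) {j : Fin n} → p j ≡ true →
  ∃ λ k → p k ≡ true × (∀ i → i Fin.< k → p i ≢ true)
least {suc n} p {j} e with p zero in e₀
least {suc n} p {j} e | true = zero , e₀ , λ i ()
least {suc n} p {zero} e | false = case (trans (sym e₀) e) of λ ()
least {suc n} p {suc j} e | false with least (p ∘ suc) {j} e
... | k , q , l = suc k , q , λ where
  zero    _       e → case (trans (sym e₀) e) of λ ()
  (suc i) (s≤s u) e → l i u e

zeroOf : Fin n → ∃ λ (x : Fin n) → toℕ x ≡ 0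
zeroOf {suc n} _ = zero , refl

≡0-unique : {x y : Fin n} → toℕ x ≡ 0 → toℕ y ≡ 0 → x ≡ y
≡0-unique p q = Finₚ.toℕ-injective (trans p (sym q))

reflect-< : (f : Fin a → Fin m) → (∀ {x y} → x Fin.< y → f x Fin.< f y) →
  ∀ {x y} → f x Fin.< f y → x Fin.< y
reflect-< f mono {x} {y} p with ℕₚ.<-cmp (toℕ x) (toℕ y)
... | tri< q _ _ = q
... | tri≈ _ q _ rewrite Finₚ.toℕ-injective q = ⊥-elim (ℕₚ.<-irrefl refl p)
... | tri> _ _ q = ⊥-elim (ℕₚ.<-asym p (mono q))

module BlockProperties {g : Fin m → Fin n → Bool} {f : Fin a → Fin m} {h : Fin c → Fin n}
  (B : Block g f h) where
  open Block B

  sub : Fin a → Fin c → Bool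
  sub x y = g (f x) (h y)

  ¬Root : ∀ {x j} → ¬ Root g (f x) j
  ¬Root {x} (p , _) = ℕₚ.<⇒≢ (f-pos x) (sym p)

  left⁺ : ∀ {x y} → Left sub x y → Left g (f x) (h y)
  left⁺ (y' , u , p) = h y' , h-mono u , p

  left⁻ : ∀ {x y} → Left g (f x) (h y) → Left sub x y
  left⁻ (j , u , p) with row-closed p
  ... | y' , refl = y' , reflect-< h h-mono u , p

  right⁺ : ∀ {x y} → Right sub x y → Right g (f x) (h y)
  right⁺ (y' , u , p) = h y' , h-mono u , p

  right⁻ : ∀ {x y} → Right g (f x) (h y) → Right sub x y
  right⁻ (j , u , p) with row-closed p
  ... | y' , refl = y' , reflect-< h h-mono u , p

  below⁺ : ∀ {x y} → Below sub x y → Below g (f x) (h y)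
  below⁺ (x' , u , p) = f x' , f-mono u , p

  below⁻ : ∀ {x y} → Below g (f x) (h y) → Below sub x y
  below⁻ {x} (i , u , p) with col-closed p
  ... | inj₁ (q , _)    = ⊥-elim (ℕₚ.n≮0 (subst (toℕ (f x) <_) q u))
  ... | inj₂ (x' , refl) = x' , reflect-< f f-mono u , p

  above⁺ : ∀ {x y} → Above sub x y → Above g (f x) (h y)
  above⁺ (x' , u , p) = f x' , f-mono u , p

  -- The first alternative stands for the root, the one dot that can lie in a column of the block
  -- but outside its rows. It is why a child of the big root can become a root itself.
  above⁻ : ∀ {x y} → Above g (f x) (h y) → toℕ (h y) ≡ 0 ⊎ Above sub x y
  above⁻ (i , u , p) with col-closed p
  ... | inj₁ (_ , q)     = inj₁ q
  ... | inj₂ (x' , refl) = inj₂ (x' , reflect-< f f-mono u , p)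

  h-zero⁻ : ∀ {y} → toℕ (h y) ≡ 0 → toℕ y ≡ 0
  h-zero⁻ {y} q with first
  ... | y₀ , p , p' with ℕₚ.<-cmp (toℕ y₀) (toℕ y)
  ... | tri< r _ _ = ⊥-elim (ℕₚ.n≮0 (subst (toℕ (h y₀) <_) q (h-mono r)))
  ... | tri≈ _ r _ = trans (sym r) p
  ... | tri> _ _ r = ⊥-elim (ℕₚ.n≮0 (subst (toℕ y <_) p r))

  h-zero⁺ : ∀ {y} → toℕ y ≡ 0 → toℕ (h y) ≡ 0
  h-zero⁺ q with first
  ... | y₀ , p , p' rewrite ≡0-unique q p = p'

  module _ (C : IsCNAT g) (rootBelow : ∀ {i j} → Root g i j → Below g i j) where
    open IsCNAT C

    -- The leftmost dot of this row has its parent above it. Nothing in the block lies higher, so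
    -- the parent is the root and the dot sits in the first column.
    firstRow : ∀ x → toℕ x ≡ 0 → ∃ λ y → toℕ y ≡ 0 × sub x y ≡ true
    firstRow x q with least (g (f x)) (proj₂ (row (f x)))
    ... | j , e , l with parent (f x) j e
    ... | inj₁ r = ⊥-elim (¬Root r)
    ... | inj₂ (inj₂ (j' , u , e')) = ⊥-elim (l j' u e')
    ... | inj₂ (inj₁ a) with row-closed e
    ... | y , refl with above⁻ a
    ... | inj₁ p = y , h-zero⁻ p , e
    ... | inj₂ (x' , u , _) = ⊥-elim (ℕₚ.n≮0 (subst (toℕ x' <_) q u))

    restrict : IsCNAT sub
    restrict = record
      { root       = root′
      ; parent     = parent′
      ; ¬both      = λ x y e a l → ¬both (f x) (h y) e (above⁺ a) (left⁺ l)
      ; row        = row′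
      ; col        = col′
      ; belowRight = λ x y e b → right⁻ (belowRight (f x) (h y) e (below⁺ b))
      ; rightBelow = λ x y e r → below⁻ (rightBelow (f x) (h y) e (right⁺ r))
      }
      where
      -- The dot known in the first column may be the root, which is outside the block; the
      -- hypothesis that the root has a dot below it supplies one inside.
      belowRoot : ∀ {y} → toℕ (h y) ≡ 0 → ∃ λ x → sub x y ≡ true
      belowRoot {y} q with root
      ... | i , j , (p , p') , e with rootBelow (p , p')
      ... | i' , u , e' with ≡0-unique q p'
      ... | refl with col-closed e'
      ... | inj₁ (z , _) = ⊥-elim (ℕₚ.n≮0 (subst (toℕ i <_) z u))
      ... | inj₂ (x , refl) = x , e'

      row′ : ∀ x → ∃ λ y → sub x y ≡ true
      row′ x with row (f x)
      ... | j , e with row-closed e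
      ... | y , refl = y , e

      col′ : ∀ y → ∃ λ x → sub x y ≡ true
      col′ y with col (h y)
      ... | i , e with col-closed e
      ... | inj₁ (_ , q)    = belowRoot q
      ... | inj₂ (x , refl) = x , e

      root′ : ∃₂ λ x y → Root sub x y × sub x y ≡ true
      root′ with first
      ... | y₀ , _ , p' with zeroOf (proj₁ (belowRoot p'))
      ... | x , q with firstRow x q
      ... | y , q' , e = x , y , (q , q') , e

      parent′ : ∀ x y → sub x y ≡ true → Root sub x y ⊎ (Above sub x y ⊎ Left sub x y)
      parent′ x y e with parent (f x) (h y) e
      ... | inj₁ r = ⊥-elim (¬Root r)
      ... | inj₂ (inj₂ l) = inj₂ (inj₂ (left⁻ l))
      ... | inj₂ (inj₁ a) with above⁻ a
      ... | inj₂ a' = inj₂ (inj₁ a')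
      -- The dot lies in the first column with the root above it. In the first row of the block it
      -- is the new root; further down, the dot given by `firstRow` is above it.
      ... | inj₁ q with toℕ x in eq
      ... | zero = inj₁ (refl , h-zero⁻ q)
      ... | suc k with zeroOf x
      ... | x₀ , q₀ with firstRow x₀ q₀
      ... | y₀ , q' , e' with ≡0-unique q' (h-zero⁻ q)
      ... | refl = inj₂ (inj₁ (x₀ , subst (_< suc k) (sym q₀) (s≤s z≤n) , e'))

  module _ (C : IsCNAT sub) where
    open IsCNAT C

    -- Parents are inherited from the block, except that the root of the subtree gets the root of
    -- `g` above it.
    block-parent : (∀ {i j} → Root g i j → g i j ≡ true) → ∀ x y → sub x y ≡ true → Above g (f x) (h y) ⊎ Left g (f x) (h y)
    block-parent rootDot x y e with parent x y e
    ... | inj₂ (inj₁ a) = inj₁ (above⁺ a)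
    ... | inj₂ (inj₂ l) = inj₂ (left⁺ l)
    ... | inj₁ (_ , q) with zeroOf (f x)
    ... | i , p = inj₁ (i , subst (_< toℕ (f x)) (sym p) (f-pos x) , rootDot (p , h-zero⁺ q))

    block-¬both : ∀ x y → sub x y ≡ true → Above g (f x) (h y) → Left g (f x) (h y) → ⊥
    block-¬both x y e a l with left⁻ l | above⁻ a
    ... | l' | inj₂ a' = ¬both x y e a' l'
    ... | y' , u , _ | inj₁ q = ℕₚ.n≮0 (subst (toℕ y' <_) (h-zero⁻ q) u)

    block-row : ∀ x → ∃ λ j → g (f x) j ≡ true
    block-row x with row x
    ... | y , e = h y , e

    block-col : ∀ y → ∃ λ i → g i (h y) ≡ true
    block-col y with col y
    ... | x , e = f x , e

    block-belowRight : ∀ x y → sub x y ≡ true → Below g (f x) (h y) → Right g (f x) (h y)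
    block-belowRight x y e b = right⁺ (belowRight x y e (below⁻ b))

    block-rightBelow : ∀ x y → sub x y ≡ true → Right g (f x) (h y) → Below g (f x) (h y)
    block-rightBelow x y e r = below⁺ (rightBelow x y e (right⁻ r))

    block-rootBelow : ∀ {i j} → Root g i j → Below g i j
    block-rootBelow {i} {j} (p , p') with root
    ... | x , y , (q , q') , e with ≡0-unique (h-zero⁺ q') p'
    ... | refl = f x , subst (_< toℕ (f x)) (sym p) (f-pos x) , e

-- Cutting and gluing a grid along two shuffles

record Valid (σ : Shuf a b m) (τ : Shuf c d n) (g : Fin (suc m) → Fin (suc n) → Bool) : Set where
  field
    rootDot : g zero zero ≡ true
    closed  : ∀ i j → g i j ≡ true → Root g i j ⊎ side (r∷ σ) i ≡ side (l∷ τ) j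

module _ {σ : Shuf a b m} {τ : Shuf c d n} {g : Fin (suc m) → Fin (suc n) → Bool}
  (V : Valid σ τ g) where
  open Valid V

  private
    σ′ = r∷ σ
    τ′ = l∷ τ

  Root⇒dot : ∀ {i j} → Root g i j → g i j ≡ true
  Root⇒dot {zero} {zero} _ = rootDot

  -- Prefixing `r∷` to the rows and `l∷` to the columns assigns the first row to the right and the
  -- first column to the left subtree. The root then is the only dot in a row and a column of
  -- different sides. The right subtree is a block of the transposed grid, whence `flip g` in
  -- `blockR`.
  blockL : Block g (inl σ′) (inl τ′)
  blockL = record
    { f-mono = inl-mono σ′
    ; h-mono = inl-mono τ′
    ; f-pos = λ x → s≤s z≤n
    ; first = zero , refl , refl
    ; row-closed = λ {x} {j} e → rc x j (closed _ _ e)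
    ; col-closed = λ {i} {y} e → cc i y (closed _ _ e)
    }
    where
    rc : ∀ x j → Root g (inl σ′ x) j ⊎ side σ′ (inl σ′ x) ≡ side τ′ j → ∃ λ y → j ≡ inl τ′ y
    rc x j (inj₁ ())
    rc x j (inj₂ e) = inl-surj τ′ j (trans (sym e) (side-inl σ′ x))
    cc : ∀ i y → Root g i (inl τ′ y) ⊎ side σ′ i ≡ side τ′ (inl τ′ y) →
      Root g i (inl τ′ y) ⊎ ∃ λ x → i ≡ inl σ′ x
    cc i y (inj₁ r) = inj₁ r
    cc i y (inj₂ e) = inj₂ (inl-surj σ′ i (trans e (side-inl τ′ y)))

  blockR : Block (flip g) (inr τ′) (inr σ′)
  blockR = record
    { f-mono = inl-mono (swap τ′)
    ; h-mono = inl-mono (swap σ′)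
    ; f-pos = λ x → s≤s z≤n
    ; first = zero , refl , refl
    ; row-closed = λ {y} {i} e → rc y i (closed _ _ e)
    ; col-closed = λ {j} {x} e → cc j x (closed _ _ e)
    }
    where
    rc : ∀ y i → Root g i (inr τ′ y) ⊎ side σ′ i ≡ side τ′ (inr τ′ y) → ∃ λ x → i ≡ inr σ′ x
    rc y i (inj₁ ())
    rc y i (inj₂ e) = inr-surj σ′ i (trans e (side-inr τ′ y))
    cc : ∀ j x → Root g (inr σ′ x) j ⊎ side σ′ (inr σ′ x) ≡ side τ′ j →
      Root (flip g) j (inr σ′ x) ⊎ ∃ λ y → j ≡ inr τ′ y
    cc j x (inj₁ (p , q)) = inj₁ (q , p)
    cc j x (inj₂ e) = inj₂ (inr-surj τ′ j (trans (sym e) (side-inr σ′ x)))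

  private
    module L = BlockProperties blockL
    module R = BlockProperties blockR

  module _ (CL : IsCNAT L.sub) (CR : IsCNAT R.sub) where

    rootBelow : ∀ {i j} → Root g i j → Below g i j
    rootBelow r = L.block-rootBelow CL r

    rootRight : ∀ {i j} → Root g i j → Right g i j
    rootRight (p , q) = R.block-rootBelow CR (q , p)

    data DotView : Fin (suc m) → Fin (suc n) → Set where
      dotRoot : DotView zero zero
      dotL    : ∀ x y → DotView (inl σ′ x) (inl τ′ y)
      dotR    : ∀ x y → DotView (inr σ′ x) (inr τ′ y)

    dotView : ∀ i j → g i j ≡ true → DotView i j
    dotView i j e with closed i j e
    dotView zero zero e | inj₁ r = dotRoot
    ... | inj₂ q with split σ′ i | split τ′ j
    ... | isL x | isL y = dotL x y
    ... | isR x | isR y = dotR x y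
    ... | isL x | isR y = case trans (sym (side-inl σ′ x)) (trans q (side-inr τ′ y)) of λ ()
    ... | isR x | isL y = case trans (sym (side-inr σ′ x)) (trans q (side-inl τ′ y)) of λ ()

    glue : IsCNAT g
    glue = record
      { root       = zero , zero , (refl , refl) , rootDot
      ; parent     = λ i j e → par i j e (dotView i j e)
      ; ¬both      = λ i j e → both i j e (dotView i j e)
      ; row        = λ i → row′ i (split σ′ i)
      ; col        = λ j → col′ j (split τ′ j)
      ; belowRight = λ i j e → br i j e (dotView i j e)
      ; rightBelow = λ i j e → rb i j e (dotView i j e)
      }
      where
      par : ∀ i j → g i j ≡ true → DotView i j → Root g i j ⊎ (Above g i j ⊎ Left g i j)
      par _ _ e dotRoot    = inj₁ (refl , refl)
      par _ _ e (dotL x y) = inj₂ (L.block-parent CL Root⇒dot x y e)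
      par _ _ e (dotR x y) with R.block-parent CR (λ (p , q) → Root⇒dot (q , p)) y x e
      ... | inj₁ l = inj₂ (inj₂ l)
      ... | inj₂ u = inj₂ (inj₁ u)

      both : ∀ i j → g i j ≡ true → DotView i j → Above g i j → Left g i j → ⊥
      both _ _ e dotRoot    (_ , () , _)
      both _ _ e (dotL x y) u l = L.block-¬both CL x y e u l
      both _ _ e (dotR x y) u l = R.block-¬both CR y x e l u

      row′ : ∀ i → Split σ′ i → ∃ λ j → g i j ≡ true
      row′ _ (isL x) = L.block-row CL x
      row′ _ (isR x) = R.block-col CR x

      col′ : ∀ j → Split τ′ j → ∃ λ i → g i j ≡ true
      col′ _ (isL y) = L.block-col CL y
      col′ _ (isR y) = R.block-row CR y

      br : ∀ i j → g i j ≡ true → DotView i j → Below g i j → Right g i j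
      br _ _ e dotRoot    u = rootRight (refl , refl)
      br _ _ e (dotL x y) u = L.block-belowRight CL x y e u
      br _ _ e (dotR x y) u = R.block-rightBelow CR y x e u

      rb : ∀ i j → g i j ≡ true → DotView i j → Right g i j → Below g i j
      rb _ _ e dotRoot    u = rootBelow (refl , refl)
      rb _ _ e (dotL x y) u = L.block-rightBelow CL x y e u
      rb _ _ e (dotR x y) u = R.block-belowRight CR y x e u

  module _ (C : IsCNAT g) (big : 0 < m + n) where
    open IsCNAT C

    -- The leftmost dot of the second row either lies in the first column, below the root, or has
    -- its parent above it, hence in the first row and to the right of the root.
    row₁ : ∀ i → toℕ i ≡ 1 → Below g zero zero ⊎ Right g zero zero
    row₁ i q with least (g i) (proj₂ (row i))
    ... | zero , e , _ = inj₁ (i , subst (0 <_) (sym q) (s≤s z≤n) , e)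
    ... | suc j , e , l with parent i (suc j) e
    ... | inj₂ (inj₂ (j' , u , e')) = ⊥-elim (l j' u e')
    ... | inj₂ (inj₁ (zero , u , e')) = inj₂ (suc j , s≤s z≤n , e')
    ... | inj₂ (inj₁ (suc i' , u , e')) with subst (suc (suc (toℕ i')) ≤_) q u
    ... | s≤s ()

    col₁ : ∀ j → toℕ j ≡ 1 → Below g zero zero ⊎ Right g zero zero
    col₁ j q with least (λ i → g i j) (proj₂ (col j))
    ... | zero , e , _ = inj₂ (j , subst (0 <_) (sym q) (s≤s z≤n) , e)
    ... | suc i , e , l with parent (suc i) j e
    ... | inj₂ (inj₁ (i' , u , e')) = ⊥-elim (l i' u e')
    ... | inj₂ (inj₂ (zero , u , e')) = inj₁ (suc i , s≤s z≤n , e')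
    ... | inj₂ (inj₂ (suc j' , u , e')) with subst (suc (suc (toℕ j')) ≤_) q u
    ... | s≤s ()

    -- Beyond a single cell there is a second row or a second column, which exhibits one child of
    -- the root; completeness provides the other.
    rootInternal : Below g zero zero × Right g zero zero
    rootInternal = both (go big row₁ col₁)
      where
      go : ∀ {m n} → 0 < m + n → (∀ (i : Fin (suc m)) → toℕ i ≡ 1 → Below g zero zero ⊎ Right g zero zero) →
        (∀ (j : Fin (suc n)) → toℕ j ≡ 1 → Below g zero zero ⊎ Right g zero zero) →
        Below g zero zero ⊎ Right g zero zero
      go {suc m}         _ f h = f (suc zero) refl
      go {zero}  {suc n} _ f h = h (suc zero) refl
      both : Below g zero zero ⊎ Right g zero zero → Below g zero zero × Right g zero zero
      both (inj₁ u) = u , belowRight zero zero rootDot u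
      both (inj₂ u) = rightBelow zero zero rootDot u , u

    subL : IsCNAT L.sub
    subL = L.restrict C below
      where
      below : ∀ {i j} → Root g i j → Below g i j
      below {zero} {zero} _ = proj₁ rootInternal

    subR : IsCNAT R.sub
    subR = R.restrict (transpose C) right
      where
      right : ∀ {j i} → Root (flip g) j i → Right g i j
      right {zero} {zero} _ = proj₂ rootInternal

-- The two shuffles determined by a tree

module Sides {g : Fin (suc m) → Fin (suc n) → Bool} (C : IsCNAT g) where
  open IsCNAT C

  -- The side of a line is found by walking up the tree: from the first dot of a row to the top
  -- dot of its column, until the first column (false) or the first row (true) is reached.
  data RowSide : Bool → Fin (suc m) → Set where
    top  : RowSide true zero
    down : ∀ {i} → g (suc i) zero ≡ true → RowSide false (suc i)
    walk : ∀ {i i' j b} → g i (suc j) ≡ true → i' Fin.< i → g i' (suc j) ≡ true →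
           ¬ Above g i' (suc j) → RowSide b i' → RowSide b i

  -- Of two such dots the right one would have a dot above and a dot to its left. So a walk can
  -- leave a row through one column only, and with `top-unique` every step of it is forced.
  above-unique : ∀ {i j j'} → g i j ≡ true → g i j' ≡ true →
    Above g i j → Above g i j' → j ≡ j'
  above-unique {i} {j} {j'} e e' u u' with ℕₚ.<-cmp (toℕ j) (toℕ j')
  ... | tri< q _ _ = ⊥-elim (¬both i j' e' u' (j , q , e))
  ... | tri≈ _ q _ = Finₚ.toℕ-injective q
  ... | tri> _ _ q = ⊥-elim (¬both i j e u (j' , q , e'))

  top-unique : ∀ {i i' j} → g i j ≡ true → g i' j ≡ true → ¬ Above g i j → ¬ Above g i' j → i ≡ i'
  top-unique {i} {i'} e e' u u' with ℕₚ.<-cmp (toℕ i) (toℕ i')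
  ... | tri< q _ _ = ⊥-elim (u' (i , q , e))
  ... | tri≈ _ q _ = Finₚ.toℕ-injective q
  ... | tri> _ _ q = ⊥-elim (u (i' , q , e'))

  rowSide-unique : ∀ {b b' i} → RowSide b i → RowSide b' i → b ≡ b'
  rowSide-unique top top = refl
  rowSide-unique top (walk _ () _ _ _)
  rowSide-unique (down e) (down _) = refl
  rowSide-unique (down e) (walk e' q f _ _) =
    ⊥-elim (¬both _ _ e' (_ , q , f) (zero , s≤s z≤n , e))
  rowSide-unique (walk _ () _ _ _) top
  rowSide-unique (walk e' q f _ _) (down e) =
    ⊥-elim (¬both _ _ e' (_ , q , f) (zero , s≤s z≤n , e))
  rowSide-unique (walk e q f u r) (walk e' q' f' u' r')
    with above-unique e e' (_ , q , f) (_ , q' , f')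
  ... | refl with top-unique f f' u u'
  ... | refl = rowSide-unique r r'

  topDot : ∀ j → ∃ λ i → g i j ≡ true × ¬ Above g i j
  topDot j with least (λ i → g i j) (proj₂ (col j))
  ... | i , e , l = i , e , λ (i' , u , e') → l i' u e'

  rowSide : ∀ i → Acc Fin._<_ i → ∃ λ b → RowSide b i
  rowSide zero    _ = true , top
  rowSide (suc i) (acc rec) with least (g (suc i)) (proj₂ (row (suc i)))
  ... | zero  , e , _ = false , down e
  ... | suc j , e , l with parent (suc i) (suc j) e
  ... | inj₂ (inj₂ (j' , u , e')) = ⊥-elim (l j' u e')
  ... | inj₂ (inj₁ (i' , u , e')) with topDot (suc j)
  ... | k , f , v with ℕₚ.<-≤-connex (toℕ i') (toℕ k)
  ... | inj₁ q = ⊥-elim (v (i' , q , e'))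
  ... | inj₂ q with rowSide k (rec (ℕₚ.≤-<-trans q u))
  ... | b , r = b , walk e (ℕₚ.≤-<-trans q u) f v r

  rowOf : Fin (suc m) → Bool
  rowOf i = proj₁ (rowSide i (<-wellFounded i))

  rowOf-side : ∀ i → RowSide (rowOf i) i
  rowOf-side i = proj₂ (rowSide i (<-wellFounded i))

  -- A column takes the side of the row of its top dot, where a walk through this column arrives.
  colOf : Fin (suc n) → Bool
  colOf zero    = false
  colOf (suc j) = rowOf (proj₁ (topDot (suc j)))

  colOf-top : ∀ {k j} → g k (suc j) ≡ true → ¬ Above g k (suc j) → colOf (suc j) ≡ rowOf k
  colOf-top {j = j} f v = let k′ , f′ , v′ = topDot (suc j) in cong rowOf (top-unique f′ f v′ v)

  -- Outside the first column a dot is either the top dot of its column or lies below it; in the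
  -- second case the walk from its row may pass through this very column, and uniqueness of sides
  -- applies.
  closed-rowOf : ∀ i j → g i j ≡ true → Root g i j ⊎ rowOf i ≡ colOf j
  closed-rowOf zero    zero    e = inj₁ (refl , refl)
  closed-rowOf (suc i) zero    e = inj₂ (rowSide-unique (rowOf-side (suc i)) (down e))
  closed-rowOf i       (suc j) e with topDot (suc j)
  ... | k , f , v with ℕₚ.<-cmp (toℕ k) (toℕ i)
  ... | tri< q _ _ = inj₂ (trans (rowSide-unique (rowOf-side i) (walk e q f v (rowOf-side k))) (sym (colOf-top f v)))
  ... | tri≈ _ q _ = inj₂ (trans (cong rowOf (Finₚ.toℕ-injective (sym q))) (sym (colOf-top f v)))
  ... | tri> _ _ q = ⊥-elim (v (i , q , e))

  module _ {σ : Shuf a b m} {τ : Shuf c d n} where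

    -- Each step of a walk joins two rows through dots of a common column, so a valid pair puts both
    -- on the same side. Hence the tree determines the valid pair, while `sides-valid` shows that it
    -- exists.
    rowSide-valid : Valid σ τ g → ∀ {b i} → RowSide b i → side (r∷ σ) i ≡ b
    rowSide-valid V top = refl
    rowSide-valid V (down e) with Valid.closed V _ _ e
    ... | inj₂ q = q
    rowSide-valid V (walk e q f u r) with Valid.closed V _ _ e | Valid.closed V _ _ f
    ... | inj₂ p | inj₂ p' = trans p (trans (sym p') (rowSide-valid V r))

    valid-rows : Valid σ τ g → ∀ i → side σ i ≡ rowOf (suc i)
    valid-rows V i = rowSide-valid V (rowOf-side (suc i))

    valid-cols : Valid σ τ g → ∀ j → side τ j ≡ colOf (suc j)
    valid-cols V j with topDot (suc j)
    ... | k , f , v with Valid.closed V k (suc j) f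
    ... | inj₂ q = trans (sym q) (trans (rowSide-valid V (rowOf-side k)) (sym (colOf-top f v)))

    sides-valid : (∀ i → side σ i ≡ rowOf (suc i)) → (∀ j → side τ j ≡ colOf (suc j)) → Valid σ τ g
    sides-valid p q = record { rootDot = rd ; closed = cl }
      where
      rd : g zero zero ≡ true
      rd with root
      ... | zero , zero , _ , e = e
      p′ : ∀ i → side (r∷ σ) i ≡ rowOf i
      p′ zero    = refl
      p′ (suc i) = p i
      q′ : ∀ j → side (l∷ τ) j ≡ colOf j
      q′ zero    = refl
      q′ (suc j) = q j
      cl : ∀ i j → g i j ≡ true → Root g i j ⊎ side (r∷ σ) i ≡ side (l∷ τ) j
      cl i j e with closed-rowOf i j e
      ... | inj₁ r = inj₁ r
      ... | inj₂ r = inj₂ (trans (p′ i) (trans r (sym (q′ j))))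

-- Enumeration of the grids split by given shuffles

module _ (g : Fin m → Fin n → Bool) where

  private
    Above? : ∀ i j → Dec (Above g i j)
    Above? i j = any? λ i' → i' <? i ×-dec g i' j ≟ᵇ true

    Below? : ∀ i j → Dec (Below g i j)
    Below? i j = any? λ i' → i <? i' ×-dec g i' j ≟ᵇ true

    Left? : ∀ i j → Dec (Left g i j)
    Left? i j = any? λ j' → j' <? j ×-dec g i j' ≟ᵇ true

    Right? : ∀ i j → Dec (Right g i j)
    Right? i j = any? λ j' → j <? j' ×-dec g i j' ≟ᵇ true

    Root? : ∀ i j → Dec (Root g i j)
    Root? i j = toℕ i ℕ.≟ 0 ×-dec toℕ j ℕ.≟ 0

    dots? : {P : Fin m → Fin n → Set} → (∀ i j → Dec (P i j)) → Dec (∀ i j → g i j ≡ true → P i j)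
    dots? P? = all? λ i → all? λ j → g i j ≟ᵇ true →-dec P? i j

  isCNAT? : Dec (IsCNAT g)
  isCNAT? = map′
    (λ (r , p , b , x , y , u , v) → record
      { root = r ; parent = p ; ¬both = b ; row = x ; col = y ; belowRight = u ; rightBelow = v })
    (λ C → let open IsCNAT C in root , parent , ¬both , row , col , belowRight , rightBelow)
    (any? (λ i → any? λ j → Root? i j ×-dec g i j ≟ᵇ true)
      ×-dec dots? (λ i j → Root? i j ⊎-dec (Above? i j ⊎-dec Left? i j))
      ×-dec dots? (λ i j → Above? i j →-dec ¬? (Left? i j))
      ×-dec all? (λ i → any? λ j → g i j ≟ᵇ true)
      ×-dec all? (λ j → any? λ i → g i j ≟ᵇ true)
      ×-dec dots? (λ i j → Below? i j →-dec Right? i j)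
      ×-dec dots? (λ i j → Right? i j →-dec Below? i j))

toGrid : Vec (Vec Bool n) m → Fin m → Fin n → Bool
toGrid g i j = lookup (lookup g i) j

isCNATᵛ : Vec (Vec Bool n) m → Bool
isCNATᵛ g = does (isCNAT? (toGrid g))

does⁻ : {P : Set} (p : Dec P) → does p ≡ true → P
does⁻ (yes p) _ = p

does⁺ : {P : Set} (p : Dec P) → P → does p ≡ true
does⁺ (yes p) _ = refl
does⁺ (no ¬p) p = ⊥-elim (¬p p)

true-⇔ : ∀ {b c} → (b ≡ true → c ≡ true) → (c ≡ true → b ≡ true) → b ≡ c
true-⇔ {true}          f g = sym (f refl)
true-⇔ {false} {true}  f g = g refl
true-⇔ {false} {false} f g = refl

∧-true⁻ : ∀ {b c} → b ∧ c ≡ true → b ≡ true × c ≡ true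
∧-true⁻ {true} e = refl , e

∧-true⁺ : ∀ {b c} → b ≡ true → c ≡ true → b ∧ c ≡ true
∧-true⁺ refl refl = refl

agree : Shuf a b n → (Fin n → Bool) → Bool
agree []     s = true
agree (l∷ σ) s = not (s zero) ∧ agree σ (s ∘ suc)
agree (r∷ σ) s = s zero ∧ agree σ (s ∘ suc)

agree⁻ : (σ : Shuf a b n) (s : Fin n → Bool) → agree σ s ≡ true → ∀ i → side σ i ≡ s i
agree⁻ (l∷ σ) s e i with s zero in eq
agree⁻ (l∷ σ) s e zero    | false = sym eq
agree⁻ (l∷ σ) s e (suc i) | false = agree⁻ σ (s ∘ suc) e i
agree⁻ (r∷ σ) s e i with s zero in eq
agree⁻ (r∷ σ) s e zero    | true = sym eq
agree⁻ (r∷ σ) s e (suc i) | true = agree⁻ σ (s ∘ suc) e i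

agree⁺ : (σ : Shuf a b n) (s : Fin n → Bool) → (∀ i → side σ i ≡ s i) → agree σ s ≡ true
agree⁺ []     s e = refl
agree⁺ (l∷ σ) s e rewrite sym (e zero) = agree⁺ σ (s ∘ suc) (e ∘ suc)
agree⁺ (r∷ σ) s e rewrite sym (e zero) = agree⁺ σ (s ∘ suc) (e ∘ suc)

-- Each letter is dictated by `s`, so at every stage one of the two halves of the sum is zero.
sumL-agree : ∀ n (s : Fin n → Bool) → sumL (shufs n) (λ (_ , _ , σ) → ⟦ agree σ s ⟧) ≡ + 1
sumL-agree zero    s = refl
sumL-agree (suc n) s = trans (sumL-shufs-suc n _) lem
  where
  lem : sumL (shufs n) (λ (_ , _ , σ) → ⟦ not (s zero) ∧ agree σ (s ∘ suc) ⟧)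
     +ℤ sumL (shufs n) (λ (_ , _ , σ) → ⟦ s zero ∧ agree σ (s ∘ suc) ⟧) ≡ + 1
  lem with s zero
  ... | true  = cong₂ _+ℤ_ (sumL-zero (shufs n) (λ _ → refl)) (sumL-agree n (s ∘ suc))
  ... | false = cong₂ _+ℤ_ (sumL-agree n (s ∘ suc)) (sumL-zero (shufs n) (λ _ → refl))

ok : Shuf a b n → (p q : X → Bool) → Vec X n → Bool
ok []     p q v       = true
ok (l∷ σ) p q (x ∷ v) = p x ∧ ok σ p q v
ok (r∷ σ) p q (x ∷ v) = q x ∧ ok σ p q v

module _ {p q : X → Bool} where

  ok⁻ : (σ : Shuf a b n) (v : Vec X n) → ok σ p q v ≡ true → ∀ i →
    (side σ i ≡ false → p (lookup v i) ≡ true) × (side σ i ≡ true → q (lookup v i) ≡ true)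
  ok⁻ (l∷ σ) (x ∷ v) e zero    = (λ _ → proj₁ (∧-true⁻ e)) , λ ()
  ok⁻ (l∷ σ) (x ∷ v) e (suc i) = ok⁻ σ v (proj₂ (∧-true⁻ {p x} e)) i
  ok⁻ (r∷ σ) (x ∷ v) e zero    = (λ ()) , λ _ → proj₁ (∧-true⁻ e)
  ok⁻ (r∷ σ) (x ∷ v) e (suc i) = ok⁻ σ v (proj₂ (∧-true⁻ {q x} e)) i

  ok⁺ : (σ : Shuf a b n) (v : Vec X n) →
    (∀ i → side σ i ≡ false → p (lookup v i) ≡ true) →
    (∀ i → side σ i ≡ true → q (lookup v i) ≡ true) → ok σ p q v ≡ true
  ok⁺ []     []      f h = refl
  ok⁺ (l∷ σ) (x ∷ v) f h = ∧-true⁺ (f zero refl) (ok⁺ σ v (f ∘ suc) (h ∘ suc))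
  ok⁺ (r∷ σ) (x ∷ v) f h = ∧-true⁺ (h zero refl) (ok⁺ σ v (f ∘ suc) (h ∘ suc))

-- The hypotheses say that the entries of `xs` satisfying `p` are enumerated by `ys`, and those
-- satisfying `q` by `zs`; the sum then separates letter by letter along `σ`. It serves at two
-- levels, for the cells of a row and for the rows of a grid.
sumL-weave : {xs ys zs : List X} {p q : X → Bool} →
  (∀ F → sumL xs (λ x → ⟦ p x ⟧ *ℤ F x) ≡ sumL ys F) →
  (∀ F → sumL xs (λ x → ⟦ q x ⟧ *ℤ F x) ≡ sumL zs F) →
  (σ : Shuf a b n) (F : Vec X n → ℤ) →
  sumL (vecs xs n) (λ v → ⟦ ok σ p q v ⟧ *ℤ F v)
    ≡ sumL (vecs ys a) (λ u → sumL (vecs zs b) (λ w → F (weave σ u w)))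
sumL-weave P Q [] F = cong (_+ℤ + 0) (trans (ℤₚ.*-identityˡ (F [])) (sym (ℤₚ.+-identityʳ (F []))))
sumL-weave {n = suc n} {xs = xs} {ys} {zs} {p} {q} P Q (l∷_ {a} {b} σ) F = begin
  sumL (vecs xs (suc n)) (λ v → ⟦ ok (l∷ σ) p q v ⟧ *ℤ F v)
    ≡⟨ sumL-vecs-suc xs n _ ⟩
  sumL xs (λ x → sumL (vecs xs n) (λ v → ⟦ p x ∧ ok σ p q v ⟧ *ℤ F (x ∷ v)))
    ≡⟨ sumL-cong xs (λ x → trans
         (sumL-cong (vecs xs n) (λ v → trans (cong (_*ℤ F (x ∷ v)) (⟦⟧-∧ (p x) _)) (ℤₚ.*-assoc ⟦ p x ⟧ _ _)))
         (trans (sumL-*ˡ (vecs xs n) ⟦ p x ⟧ _) (cong (⟦ p x ⟧ *ℤ_) (sumL-weave P Q σ (F ∘ (x ∷_)))))) ⟩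
  sumL xs (λ x → ⟦ p x ⟧ *ℤ sumL (vecs ys a) (λ u → sumL (vecs zs b) (λ w → F (x ∷ weave σ u w))))
    ≡⟨ P _ ⟩
  sumL ys (λ x → sumL (vecs ys a) (λ u → sumL (vecs zs b) (λ w → F (x ∷ weave σ u w))))
    ≡⟨ sumL-vecs-suc ys a _ ⟨
  sumL (vecs ys (suc a)) (λ u → sumL (vecs zs b) (λ w → F (weave (l∷ σ) u w))) ∎
  where open ≡-Reasoning
sumL-weave {n = suc n} {xs = xs} {ys} {zs} {p} {q} P Q (r∷_ {a} {b} σ) F = begin
  sumL (vecs xs (suc n)) (λ v → ⟦ ok (r∷ σ) p q v ⟧ *ℤ F v)
    ≡⟨ sumL-vecs-suc xs n _ ⟩
  sumL xs (λ x → sumL (vecs xs n) (λ v → ⟦ q x ∧ ok σ p q v ⟧ *ℤ F (x ∷ v)))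
    ≡⟨ sumL-cong xs (λ x → trans
         (sumL-cong (vecs xs n) (λ v → trans (cong (_*ℤ F (x ∷ v)) (⟦⟧-∧ (q x) _)) (ℤₚ.*-assoc ⟦ q x ⟧ _ _)))
         (trans (sumL-*ˡ (vecs xs n) ⟦ q x ⟧ _) (cong (⟦ q x ⟧ *ℤ_) (sumL-weave P Q σ (F ∘ (x ∷_)))))) ⟩
  sumL xs (λ x → ⟦ q x ⟧ *ℤ sumL (vecs ys a) (λ u → sumL (vecs zs b) (λ w → F (x ∷ weave σ u w))))
    ≡⟨ Q _ ⟩
  sumL zs (λ x → sumL (vecs ys a) (λ u → sumL (vecs zs b) (λ w → F (x ∷ weave σ u w))))
    ≡⟨ sumL-swap zs (vecs ys a) _ ⟩
  sumL (vecs ys a) (λ u → sumL zs (λ x → sumL (vecs zs b) (λ w → F (x ∷ weave σ u w))))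
    ≡⟨ sumL-cong (vecs ys a) (λ u → sym (sumL-vecs-suc zs b _)) ⟩
  sumL (vecs ys a) (λ u → sumL (vecs zs (suc b)) (λ w → F (weave (r∷ σ) u w))) ∎
  where open ≡-Reasoning

sumL-vecs-singleton : (x : X) (n : ℕ) (F : Vec X n → ℤ) → sumL (vecs (x ∷ []) n) F ≡ F (replicate n x)
sumL-vecs-singleton x zero    F = ℤₚ.+-identityʳ _
sumL-vecs-singleton x (suc n) F = trans (sumL-vecs-suc (x ∷ []) n F)
  (trans (ℤₚ.+-identityʳ _) (sumL-vecs-singleton x n _))

sumL-vecs-map : {Y : Set} (φ : X → Y) (xs : List X) (n : ℕ) (F : Vec Y n → ℤ) →
  sumL (vecs (List.map φ xs) n) F ≡ sumL (vecs xs n) (F ∘ Vec.map φ)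
sumL-vecs-map φ xs zero    F = refl
sumL-vecs-map φ xs (suc n) F = trans (sumL-vecs-suc (List.map φ xs) n F) (trans (sumL-map φ xs _)
  (trans (sumL-cong xs (λ x → sumL-vecs-map φ xs n (F ∘ (φ x ∷_)))) (sym (sumL-vecs-suc xs n _))))

leftOnly : Shuf a b n → Vec Bool n → Bool
leftOnly τ = ok τ (λ _ → true) not

falses : Vec Bool n
falses = replicate _ false

padʳ : Shuf a b n → Vec Bool a → Vec Bool n
padʳ τ u = weave τ u falses

padˡ : Shuf a b n → Vec Bool b → Vec Bool n
padˡ τ w = weave τ falses w

sumL-leftOnly : (τ : Shuf a b n) (F : Vec Bool n → ℤ) →
  sumL (vecs bits n) (λ r → ⟦ leftOnly τ r ⟧ *ℤ F r) ≡ sumL (vecs bits a) (F ∘ padʳ τ)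
sumL-leftOnly {a} {b} τ F = trans
  (sumL-weave {zs = false ∷ []} (λ F → sumL-cong bits (λ x → ℤₚ.*-identityˡ (F x)))
    (λ F → trans (ℤₚ.+-identityˡ _) (cong (_+ℤ + 0) (ℤₚ.*-identityˡ (F false)))) τ F)
  (sumL-cong (vecs bits a) (λ u → sumL-vecs-singleton false b _))

sumL-rightOnly : (τ : Shuf a b n) (F : Vec Bool n → ℤ) →
  sumL (vecs bits n) (λ r → ⟦ leftOnly (swap τ) r ⟧ *ℤ F r) ≡ sumL (vecs bits b) (F ∘ padˡ τ)
sumL-rightOnly {b = b} τ F = trans (sumL-leftOnly (swap τ) F)
  (sumL-cong (vecs bits b) (λ u → cong F (weave-swap τ falses u)))

topOk : Shuf c d n → Vec Bool (suc n) → Bool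
topOk τ (x ∷ r) = x ∧ leftOnly (swap τ) r

valid : Shuf a b m → Shuf c d n → Vec (Vec Bool (suc n)) (suc m) → Bool
valid σ τ (r₀ ∷ rs) = topOk τ r₀ ∧ ok σ (leftOnly (l∷ τ)) (leftOnly (swap (l∷ τ))) rs

-- The top row of the right grid continues the row of the root, so it is padded along `τ` and put
-- behind the root dot; the other rows are padded along `l∷ τ`, which includes the first column.
join : Shuf a b m → Shuf c d n → Vec (Vec Bool (suc c)) a → Vec (Vec Bool d) (suc b) →
  Vec (Vec Bool (suc n)) (suc m)
join σ τ L (r₀ ∷ R) =
  (true ∷ padˡ τ r₀) ∷ weave σ (Vec.map (padʳ (l∷ τ)) L) (Vec.map (padˡ (l∷ τ)) R)

-- This is the statement that `join σ τ` runs exactly once through the valid grids, in the form in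
-- which the recursion uses it.
sumL-valid : (σ : Shuf a b m) (τ : Shuf c d n) (F : Vec (Vec Bool (suc n)) (suc m) → ℤ) →
  sumL (grids (suc m) (suc n)) (λ g → ⟦ valid σ τ g ⟧ *ℤ F g)
    ≡ sumL (grids a (suc c)) (λ L → sumL (grids (suc b) d) (λ R → F (join σ τ L R)))
sumL-valid {a} {b} {m} {c} {d} {n} σ τ F = begin
  sumL (grids (suc m) (suc n)) (λ g → ⟦ valid σ τ g ⟧ *ℤ F g)
    ≡⟨ sumL-vecs-suc (vecs bits (suc n)) m _ ⟩
  sumL (vecs bits (suc n)) (λ r → sumL rest (λ g → ⟦ topOk τ r ∧ okRest g ⟧ *ℤ F (r ∷ g)))
    ≡⟨ sumL-cong (vecs bits (suc n)) (λ r → trans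
         (sumL-cong rest (λ g → trans (cong (_*ℤ F (r ∷ g)) (⟦⟧-∧ (topOk τ r) _)) (ℤₚ.*-assoc ⟦ topOk τ r ⟧ _ _)))
         (trans (sumL-*ˡ rest ⟦ topOk τ r ⟧ _) (cong (⟦ topOk τ r ⟧ *ℤ_) (lower (F ∘ (r ∷_)))))) ⟩
  sumL (vecs bits (suc n)) (λ r → ⟦ topOk τ r ⟧ *ℤ H r)
    ≡⟨ sumL-vecs-suc bits n _ ⟩
  sumL (vecs bits n) (λ r → ⟦ leftOnly (swap τ) r ⟧ *ℤ H (true ∷ r))
    +ℤ (sumL (vecs bits n) (λ r → + 0 *ℤ H (false ∷ r)) +ℤ + 0)
    ≡⟨ cong₂ _+ℤ_ (sumL-rightOnly τ (H ∘ (true ∷_))) (cong (_+ℤ + 0) (sumL-zero (vecs bits n) (λ _ → refl))) ⟩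
  sumL (vecs bits d) (λ r → H (true ∷ padˡ τ r)) +ℤ + 0
    ≡⟨ ℤₚ.+-identityʳ _ ⟩
  sumL (vecs bits d) (λ r → H (true ∷ padˡ τ r))
    ≡⟨ sumL-swap (vecs bits d) (grids a (suc c)) _ ⟩
  sumL (grids a (suc c)) (λ L → sumL (vecs bits d) (λ r → sumL (grids b d) (λ R → F (join σ τ L (r ∷ R)))))
    ≡⟨ sumL-cong (grids a (suc c)) (λ L → sym (sumL-vecs-suc (vecs bits d) b _)) ⟩
  sumL (grids a (suc c)) (λ L → sumL (grids (suc b) d) (λ R → F (join σ τ L R))) ∎
  where
  open ≡-Reasoning
  rest = vecs (vecs bits (suc n)) m
  okRest = ok σ (leftOnly (l∷ τ)) (leftOnly (swap (l∷ τ)))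
  below : (Vec (Vec Bool (suc n)) m → ℤ) → ℤ
  below F = sumL (grids a (suc c)) (λ L → sumL (grids b d) (λ R →
    F (weave σ (Vec.map (padʳ (l∷ τ)) L) (Vec.map (padˡ (l∷ τ)) R))))
  H : Vec Bool (suc n) → ℤ
  H r = below (F ∘ (r ∷_))
  lower : ∀ F → sumL rest (λ g → ⟦ okRest g ⟧ *ℤ F g) ≡ below F
  lower F = trans
    (sumL-weave {ys = List.map (padʳ (l∷ τ)) (vecs bits (suc c))} {zs = List.map (padˡ (l∷ τ)) (vecs bits d)}
      (λ F → trans (sumL-leftOnly (l∷ τ) F) (sym (sumL-map _ (vecs bits (suc c)) F)))
      (λ F → trans (sumL-rightOnly (l∷ τ) F) (sym (sumL-map _ (vecs bits d) F))) σ F)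
    (trans (sumL-vecs-map _ (vecs bits (suc c)) a _)
      (sumL-cong (grids a (suc c)) (λ L → sumL-vecs-map _ (vecs bits d) b _)))

leftOnly⁻ : (τ : Shuf a b n) (r : Vec Bool n) → leftOnly τ r ≡ true →
  ∀ i → lookup r i ≡ true → side τ i ≡ false
leftOnly⁻ τ r e i q with side τ i in s
... | false = refl
... | true  = case trans (sym (cong not q)) (proj₂ (ok⁻ τ r e i) s) of λ ()

leftOnly⁺ : (τ : Shuf a b n) (r : Vec Bool n) →
  (∀ i → lookup r i ≡ true → side τ i ≡ false) → leftOnly τ r ≡ true
leftOnly⁺ τ r f = ok⁺ τ r (λ _ _ → refl) h
  where
  h : ∀ i → side τ i ≡ true → not (lookup r i) ≡ true
  h i s with lookup r i in q
  ... | false = refl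
  ... | true  = trans (sym (f i q)) s

rightOnly⁻ : (τ : Shuf a b n) (r : Vec Bool n) → leftOnly (swap τ) r ≡ true →
  ∀ i → lookup r i ≡ true → side τ i ≡ true
rightOnly⁻ τ r e i q = not-false (trans (sym (side-swap τ i)) (leftOnly⁻ (swap τ) r e i q))

rightOnly⁺ : (τ : Shuf a b n) (r : Vec Bool n) →
  (∀ i → lookup r i ≡ true → side τ i ≡ true) → leftOnly (swap τ) r ≡ true
rightOnly⁺ τ r f = leftOnly⁺ (swap τ) r (λ i q → trans (side-swap τ i) (not-true (f i q)))

valid⁻ : (σ : Shuf a b m) (τ : Shuf c d n) (g : Vec (Vec Bool (suc n)) (suc m)) →
  valid σ τ g ≡ true → Valid σ τ (toGrid g)
valid⁻ σ τ ((x ∷ r) ∷ g) e = record { rootDot = proj₁ (∧-true⁻ e₁) ; closed = cl }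
  where
  e₁ = proj₁ (∧-true⁻ {x ∧ leftOnly (swap τ) r} e)
  e₂ = proj₂ (∧-true⁻ {x ∧ leftOnly (swap τ) r} e)
  cl : ∀ i j → toGrid ((x ∷ r) ∷ g) i j ≡ true →
    Root (toGrid ((x ∷ r) ∷ g)) i j ⊎ side (r∷ σ) i ≡ side (l∷ τ) j
  cl zero    zero    q = inj₁ (refl , refl)
  cl zero    (suc j) q = inj₂ (sym (rightOnly⁻ τ r (proj₂ (∧-true⁻ {x} e₁)) j q))
  cl (suc i) j       q with side σ i in s
  ... | false = inj₂ (sym (leftOnly⁻ (l∷ τ) (lookup g i) (proj₁ (ok⁻ σ g e₂ i) s) j q))
  ... | true  = inj₂ (sym (rightOnly⁻ (l∷ τ) (lookup g i) (proj₂ (ok⁻ σ g e₂ i) s) j q))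

valid⁺ : (σ : Shuf a b m) (τ : Shuf c d n) (g : Vec (Vec Bool (suc n)) (suc m)) →
  Valid σ τ (toGrid g) → valid σ τ g ≡ true
valid⁺ σ τ ((x ∷ r) ∷ g) V =
  ∧-true⁺ (∧-true⁺ rootDot (rightOnly⁺ τ r λ j q → row₀ j q (closed zero (suc j) q)))
    (ok⁺ σ g (λ i s → leftOnly⁺ (l∷ τ) (lookup g i) (λ j q → trans (sym (rowₛ i j q (closed (suc i) j q))) s))
             (λ i s → rightOnly⁺ (l∷ τ) (lookup g i) (λ j q → trans (sym (rowₛ i j q (closed (suc i) j q))) s)))
  where
  open Valid V
  row₀ : ∀ j → lookup r j ≡ true → Root (toGrid ((x ∷ r) ∷ g)) zero (suc j) ⊎ true ≡ side τ j → side τ j ≡ true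
  row₀ j q (inj₂ e) = sym e
  rowₛ : ∀ i j → lookup (lookup g i) j ≡ true →
    Root (toGrid ((x ∷ r) ∷ g)) (suc i) j ⊎ side σ i ≡ side (l∷ τ) j → side σ i ≡ side (l∷ τ) j
  rowₛ i j q (inj₂ e) = e

module _ (σ : Shuf a b m) (τ : Shuf c d n)
  (L : Vec (Vec Bool (suc c)) a) (r₀ : Vec Bool d) (R′ : Vec (Vec Bool d) b) where

  private
    R = r₀ ∷ R′
    J = toGrid (join σ τ L R)
    σ′ = r∷ σ
    τ′ = l∷ τ

  join-ll : ∀ x y → J (inl σ′ x) (inl τ′ y) ≡ toGrid L x y
  join-ll x y
    rewrite lookup-weaveˡ σ (Vec.map (padʳ τ′) L) (Vec.map (padˡ τ′) R′) x
          | Vecₚ.lookup-map x (padʳ τ′) L = lookup-weaveˡ τ′ (lookup L x) falses y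

  join-lr : ∀ x y → J (inl σ′ x) (inr τ′ y) ≡ false
  join-lr x y
    rewrite lookup-weaveˡ σ (Vec.map (padʳ τ′) L) (Vec.map (padˡ τ′) R′) x
          | Vecₚ.lookup-map x (padʳ τ′) L =
      trans (lookup-weaveʳ τ′ (lookup L x) falses y) (Vecₚ.lookup-replicate y false)

  join-rr : ∀ x y → J (inr σ′ x) (inr τ′ y) ≡ toGrid R x y
  join-rr zero y = lookup-weaveʳ τ falses r₀ y
  join-rr (suc x) y
    rewrite lookup-weaveʳ σ (Vec.map (padʳ τ′) L) (Vec.map (padˡ τ′) R′) x
          | Vecₚ.lookup-map x (padˡ τ′) R′ = lookup-weaveʳ τ′ falses (lookup R′ x) y

  join-rl : ∀ x y → J (inr σ′ x) (inl τ′ y) ≡ true → toℕ x ≡ 0 × toℕ y ≡ 0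
  join-rl zero zero e = refl , refl
  join-rl zero (suc y) e =
    case trans (sym e) (trans (lookup-weaveˡ τ falses r₀ y) (Vecₚ.lookup-replicate y false)) of λ ()
  join-rl (suc x) y e
    rewrite lookup-weaveʳ σ (Vec.map (padʳ τ′) L) (Vec.map (padˡ τ′) R′) x
          | Vecₚ.lookup-map x (padˡ τ′) R′ =
      case trans (sym e) (trans (lookup-weaveˡ τ′ falses (lookup R′ x) y) (Vecₚ.lookup-replicate y false)) of λ ()

  join-00 : J zero zero ≡ true
  join-00 = refl

  join-valid : Valid σ τ J
  join-valid = record { rootDot = join-00 ; closed = λ i j → cl i j (split σ′ i) (split τ′ j) }
    where
    cl : ∀ i j → Split σ′ i → Split τ′ j → J i j ≡ true → Root J i j ⊎ side σ′ i ≡ side τ′ j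
    cl _ _ (isL x) (isL y) e = inj₂ (trans (side-inl σ′ x) (sym (side-inl τ′ y)))
    cl _ _ (isR x) (isR y) e = inj₂ (trans (side-inr σ′ x) (sym (side-inr τ′ y)))
    cl _ _ (isL x) (isR y) e = case trans (sym e) (join-lr x y) of λ ()
    cl _ _ (isR x) (isL y) e with join-rl x y e
    cl _ _ (isR zero) (isL zero) e | refl , refl = inj₁ (refl , refl)

  -- For `m + n` equal to 0 the joined grid is the one-cell tree, whose root is a leaf, while `L`
  -- and `R` have a side of length 0 and are no trees.
  join-CNAT : 0 < m + n → isCNATᵛ (join σ τ L R) ≡ isCNATᵛ L ∧ isCNATᵛ R
  join-CNAT big = true-⇔
    (λ e → let C = does⁻ (isCNAT? J) e in
      ∧-true⁺ (does⁺ (isCNAT? (toGrid L)) (IsCNAT-ext join-ll (subL join-valid C big)))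
              (does⁺ (isCNAT? (toGrid R)) (transpose (IsCNAT-ext (λ y x → join-rr x y) (subR join-valid C big)))))
    (λ e → let eL , eR = ∧-true⁻ {isCNATᵛ L} e in
      does⁺ (isCNAT? J) (glue join-valid
        (IsCNAT-ext (λ x y → sym (join-ll x y)) (does⁻ (isCNAT? (toGrid L)) eL))
        (IsCNAT-ext (λ y x → sym (join-rr x y)) (transpose (does⁻ (isCNAT? (toGrid R)) eR)))))

-- A pair is valid exactly when it agrees with the sides found by walking up the tree, and exactly
-- one shuffle has given sides.
sumL-valid-one : (g : Vec (Vec Bool (suc n)) (suc m)) → isCNATᵛ g ≡ true →
  sumL (shufs m) (λ (_ , _ , σ) → sumL (shufs n) (λ (_ , _ , τ) → ⟦ valid σ τ g ⟧)) ≡ + 1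
sumL-valid-one {n} {m} g e = begin
  sumL (shufs m) (λ (_ , _ , σ) → sumL (shufs n) (λ (_ , _ , τ) → ⟦ valid σ τ g ⟧))
    ≡⟨ sumL-cong (shufs m) (λ (_ , _ , σ) → trans
         (sumL-cong (shufs n) (λ (_ , _ , τ) → trans (cong ⟦_⟧ (valid-agree σ τ)) (⟦⟧-∧ (agree σ s) _)))
         (trans (sumL-*ˡ (shufs n) ⟦ agree σ s ⟧ _)
           (trans (cong (⟦ agree σ s ⟧ *ℤ_) (sumL-agree n t)) (ℤₚ.*-identityʳ _)))) ⟩
  sumL (shufs m) (λ (_ , _ , σ) → ⟦ agree σ s ⟧)
    ≡⟨ sumL-agree m s ⟩
  + 1 ∎
  where
  open ≡-Reasoning
  open Sides (does⁻ (isCNAT? (toGrid g)) e)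
  s = rowOf ∘ suc
  t = colOf ∘ suc
  valid-agree : ∀ {a b c d} (σ : Shuf a b m) (τ : Shuf c d n) → valid σ τ g ≡ agree σ s ∧ agree τ t
  valid-agree σ τ = true-⇔
    (λ e → let V = valid⁻ σ τ g e in
      ∧-true⁺ (agree⁺ σ s (valid-rows V)) (agree⁺ τ t (valid-cols V)))
    (λ e → let p , q = ∧-true⁻ {agree σ s} e in
      valid⁺ σ τ g (sides-valid (agree⁻ σ s p) (agree⁻ τ t q)))

-- The recursion for weighted counts

Weight : Set
Weight = ∀ {m n} → Vec (Vec Bool n) m → ℤ

total : Weight → ℕ → ℕ → ℤ
total w m n = sumL (grids m n) (λ g → ⟦ isCNATᵛ g ⟧ *ℤ w g)

Sign : Set
Sign = ∀ {a b c d m n} → Shuf a b m → Shuf c d n → ℤ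

-- Covers both recursions: constant weight and sign 1 for the number of trees, the determinant with
-- `splitSign` for the signed count. It is asked of trees only, because the factorisation of the
-- determinant uses that `L` is square.
Multiplicative : Weight → Sign → Set
Multiplicative w e = ∀ {a b c d m n} (σ : Shuf a b m) (τ : Shuf c d n)
  (L : Vec (Vec Bool (suc c)) a) (R : Vec (Vec Bool d) (suc b)) →
  isCNATᵛ L ≡ true → isCNATᵛ R ≡ true → w (join σ τ L R) ≡ e σ τ *ℤ (w L *ℤ w R)

module _ {w : Weight} {e : Sign} (mult : Multiplicative w e) where

  total-rec : 0 < m + n → total w (suc m) (suc n) ≡
    sumL (shufs m) (λ (a , b , σ) → sumL (shufs n) (λ (c , d , τ) →
      e σ τ *ℤ (total w a (suc c) *ℤ total w (suc b) d)))
  total-rec {m} {n} big = begin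
    sumL gs (λ g → F g)
      -- Multiplication by `N g`, the number of valid pairs, which is 1 wherever the indicator of
      -- CNATs is not zero.
      ≡⟨ sumL-cong gs (λ g → trans (⟦⟧*-cong (isCNATᵛ g) (λ e → trans (sym (ℤₚ.*-identityˡ (w g)))
           (cong (_*ℤ w g) (sym (sumL-valid-one g e)))))
           (assoc ⟦ isCNATᵛ g ⟧ (w g) (N g))) ⟩
    sumL gs (λ g → N g *ℤ F g)
      ≡⟨ sumL-cong gs (λ g → trans (sym (sumL-*ʳ (shufs m) (F g) _))
           (sumL-cong (shufs m) (λ _ → sym (sumL-*ʳ (shufs n) (F g) _)))) ⟩
    sumL gs (λ g → sumL (shufs m) (λ (_ , _ , σ) → sumL (shufs n) (λ (_ , _ , τ) → ⟦ valid σ τ g ⟧ *ℤ F g)))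
      ≡⟨ trans (sumL-swap gs (shufs m) _) (sumL-cong (shufs m) (λ _ → sumL-swap gs (shufs n) _)) ⟩
    sumL (shufs m) (λ (_ , _ , σ) → sumL (shufs n) (λ (_ , _ , τ) → sumL gs (λ g → ⟦ valid σ τ g ⟧ *ℤ F g)))
      ≡⟨ sumL-cong (shufs m) (λ (_ , _ , σ) → sumL-cong (shufs n) (λ (_ , _ , τ) → sumL-valid σ τ F)) ⟩
    sumL (shufs m) (λ (a , b , σ) → sumL (shufs n) (λ (c , d , τ) →
      sumL (grids a (suc c)) (λ L → sumL (grids (suc b) d) (λ R → F (join σ τ L R)))))
      ≡⟨ sumL-cong (shufs m) (λ (a , b , σ) → sumL-cong (shufs n) (λ (c , d , τ) → trans
           (sumL-cong (grids a (suc c)) (λ L → sumL-cong (grids (suc b) d) (λ R → joinF σ τ L R)))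
           (sumL-product (grids a (suc c)) (grids (suc b) d) (e σ τ) F F))) ⟩
    sumL (shufs m) (λ (a , b , σ) → sumL (shufs n) (λ (c , d , τ) →
      e σ τ *ℤ (total w a (suc c) *ℤ total w (suc b) d))) ∎
    where
    open ≡-Reasoning
    gs = grids (suc m) (suc n)
    N : Vec (Vec Bool (suc n)) (suc m) → ℤ
    N g = sumL (shufs m) (λ (_ , _ , σ) → sumL (shufs n) (λ (_ , _ , τ) → ⟦ valid σ τ g ⟧))
    F : ∀ {m n} → Vec (Vec Bool n) m → ℤ
    F g = ⟦ isCNATᵛ g ⟧ *ℤ w g
    assoc : ∀ x y z → x *ℤ (z *ℤ y) ≡ z *ℤ (x *ℤ y)
    assoc = solve-∀
    shape : ∀ x y e u v → x *ℤ y *ℤ (e *ℤ (u *ℤ v)) ≡ e *ℤ (x *ℤ u *ℤ (y *ℤ v))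
    shape = solve-∀
    joinF : ∀ {a b c d} (σ : Shuf a b m) (τ : Shuf c d n)
      (L : Vec (Vec Bool (suc c)) a) (R : Vec (Vec Bool d) (suc b)) →
      F (join σ τ L R) ≡ e σ τ *ℤ (F L *ℤ F R)
    joinF σ τ L R@(r₀ ∷ R′) rewrite join-CNAT σ τ L r₀ R′ big = trans
      (⟦⟧*-cong (isCNATᵛ L ∧ isCNATᵛ R) (λ q →
        let p , p′ = ∧-true⁻ {isCNATᵛ L} q in mult σ τ L R p p′))
      (trans (cong (_*ℤ (e σ τ *ℤ (w L *ℤ w R))) (⟦⟧-∧ (isCNATᵛ L) (isCNATᵛ R)))
        (shape ⟦ isCNATᵛ L ⟧ ⟦ isCNATᵛ R ⟧ (e σ τ) (w L) (w R)))

-- Determinants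

leftSub : Shuf a b m → Shuf c d n → (Fin (suc m) → Fin (suc n) → Bool) → Fin a → Fin (suc c) → Bool
leftSub σ τ g x y = g (inl (r∷ σ) x) (inl (l∷ τ) y)

rightSub : Shuf a b m → Shuf c d n → (Fin (suc m) → Fin (suc n) → Bool) → Fin (suc b) → Fin d → Bool
rightSub σ τ g x y = g (inr (r∷ σ) x) (inr (l∷ τ) y)

shufOf : ∀ n (s : Fin n → Bool) → ∃₂ λ a b → ∃ λ (σ : Shuf a b n) → ∀ i → side σ i ≡ s i
shufOf zero    s = 0 , 0 , [] , λ ()
shufOf (suc n) s with s zero in eq | shufOf n (s ∘ suc)
... | false | a , b , σ , p = suc a , b , l∷ σ , λ where
  zero    → sym eq
  (suc i) → p i
... | true  | a , b , σ , p = a , suc b , r∷ σ , λ where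
  zero    → sym eq
  (suc i) → p i

shuf-≤ : Shuf a b n → a ≤ n × b ≤ n
shuf-≤ {a} {b} σ rewrite sym (shuf-size σ) = ℕₚ.m≤m+n a b , ℕₚ.m≤n+m b a

module _ (P : ∀ {m n} → (Fin m → Fin n → Bool) → Set)
  (leaf : ∀ (g : Fin 1 → Fin 1 → Bool) → IsCNAT g → P g)
  (node : ∀ {a b c d m n} (σ : Shuf a b m) (τ : Shuf c d n) g → Valid σ τ g →
    P (leftSub σ τ g) → P (rightSub σ τ g) → P g) where

  private
    ind  : ∀ k {m n} → m + n ≤ k → (g : Fin m → Fin n → Bool) → IsCNAT g → P g
    step : ∀ k {m n} → m + suc n ≤ k → (g : Fin (suc m) → Fin (suc n) → Bool) → IsCNAT g → 0 < m + n → P g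

    ind _ {zero} q g C with IsCNAT.root C
    ... | () , _
    ind _ {suc m} {zero} q g C with IsCNAT.root C
    ... | _ , () , _
    ind _ {suc zero} {suc zero} q g C = leaf g C
    ind (suc k) {suc zero} {suc (suc n)} (s≤s q) g C = step k q g C (s≤s z≤n)
    ind (suc k) {suc (suc m)} {suc n} (s≤s q) g C = step k q g C (s≤s z≤n)

    step k {m} {n} q g C big =
      let open Sides C
          a , b , σ , p = shufOf m (rowOf ∘ suc)
          c , d , τ , p′ = shufOf n (colOf ∘ suc)
          V = sides-valid p p′
          a≤m , b≤m = shuf-≤ σ
          c≤n , d≤n = shuf-≤ τ
      in node σ τ g V
        (ind k (ℕₚ.≤-trans (ℕₚ.+-mono-≤ a≤m (s≤s c≤n)) q) (leftSub σ τ g) (subL V C big))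
        (ind k (ℕₚ.≤-trans (subst (suc b + d ≤_) (sym (ℕₚ.+-suc m n)) (s≤s (ℕₚ.+-mono-≤ b≤m d≤n))) q)
          (rightSub σ τ g) (transpose (subR V C big)))

  -- Structural induction on the tree, run as a recursion on `m + n`, which drops because each
  -- subtree loses the row or the column of the root.
  IsCNAT-ind : (g : Fin m → Fin n → Bool) → IsCNAT g → P g
  IsCNAT-ind g C = ind _ ℕₚ.≤-refl g C

split-square : Shuf a b m → Shuf c d n → a ≡ suc c → suc b ≡ d → suc m ≡ suc n
split-square {b = b} {c = c} σ τ refl refl =
  cong suc (trans (sym (shuf-size σ)) (trans (sym (ℕₚ.+-suc c b)) (shuf-size τ)))

-- If the subtrees are square, then `a = c + 1` and `b + 1 = d`, hence `a + b = c + 1 + b = c + d`.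
IsCNAT-square : (g : Fin m → Fin n → Bool) → IsCNAT g → m ≡ n
IsCNAT-square = IsCNAT-ind (λ {m} {n} _ → m ≡ n) (λ _ _ → refl) (λ σ τ _ _ → split-square σ τ)

-- The signed sum over injections of rows into columns. Allowing different numbers of rows and
-- columns spares the block factorisation all casts between sizes that are equal only by arithmetic.
detR : ∀ m n → (Fin m → Fin n → ℤ) → ℤ
detR zero    n       A = + 1
detR (suc m) zero    A = + 0
detR (suc m) (suc n) A = sumL (allFin (suc n))
  (λ j → sign (toℕ j) *ℤ (A zero j *ℤ detR m n (λ i k → A (suc i) (punchIn j k))))

detR-cong : ∀ m n {A B : Fin m → Fin n → ℤ} → (∀ i j → A i j ≡ B i j) → detR m n A ≡ detR m n B
detR-cong zero    n       e = refl
detR-cong (suc m) zero    e = refl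
detR-cong (suc m) (suc n) e = sumL-cong (allFin (suc n)) (λ j → cong₂ (λ x y → sign (toℕ j) *ℤ (x *ℤ y))
  (e zero j) (detR-cong m n (λ i k → e (suc i) (punchIn j k))))

foldr-map-sumL : (xs : List X) (f : X → ℤ) → List.foldr _+ℤ_ (+ 0) (List.map f xs) ≡ sumL xs f
foldr-map-sumL []       f = refl
foldr-map-sumL (x ∷ xs) f = cong (f x +ℤ_) (foldr-map-sumL xs f)

det-detR : ∀ n (A : Fin n → Fin n → ℤ) → det n A ≡ detR n n A
det-detR zero    A = refl
det-detR (suc n) A = trans
  (foldr-map-sumL (allFin (suc n)) (λ j → sign (toℕ j) *ℤ (A zero j *ℤ det n (λ i k → A (suc i) (punchIn j k)))))
  (sumL-cong (allFin (suc n)) (λ j → cong (λ x → sign (toℕ j) *ℤ (A zero j *ℤ x)) (det-detR n _)))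

-- The sign of the permutation sorting σ, that is, the parity of the pairs with a right entry
-- before a left entry.
sgn : Shuf a b n → ℤ
sgn []               = + 1
sgn (l∷ σ)           = sgn σ
sgn (r∷_ {a = a} σ)  = sign a *ℤ sgn σ

sign-square : ∀ a → sign a *ℤ sign a ≡ + 1
sign-square zero    = refl
sign-square (suc a) = trans (neg-neg (sign a)) (sign-square a)
  where
  neg-neg : ∀ x → (- x) *ℤ (- x) ≡ x *ℤ x
  neg-neg = solve-∀

sgn-noL : (σ : Shuf 0 b n) → sgn σ ≡ + 1
sgn-noL []     = refl
sgn-noL (r∷ σ) = trans (ℤₚ.*-identityˡ _) (sgn-noL σ)

-- Striking out a column in the Laplace expansion removes one letter from its shuffle. `delL` and
-- `delR` give the remaining shuffle, and the `punchIn` lemmas identify its positions in the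
-- original grid.
delL : Shuf (suc a) b (suc n) → Fin (suc a) → Shuf a b n
delL             (l∷ σ) zero    = σ
delL {suc a} {n = suc n} (l∷ σ) (suc x) = l∷ delL σ x
delL {n = suc n} (r∷ σ) x       = r∷ delL σ x

delR : Shuf a (suc b) (suc n) → Fin (suc b) → Shuf a b n
delR             (r∷ σ) zero    = σ
delR {n = suc n} (l∷ σ) y       = l∷ delR σ y
delR {b = suc b} {n = suc n} (r∷ σ) (suc y) = r∷ delR σ y

swap-delR : (σ : Shuf a (suc b) (suc n)) (y : Fin (suc b)) → swap (delR σ y) ≡ delL (swap σ) y
swap-delR             (r∷ σ) zero    = refl
swap-delR {n = suc n} (l∷ σ) y       = cong r∷_ (swap-delR σ y)
swap-delR {b = suc b} {n = suc n} (r∷ σ) (suc y) = cong l∷_ (swap-delR σ y)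

punchIn-delLˡ : (σ : Shuf (suc a) b (suc n)) (x : Fin (suc a)) (k : Fin a) →
  punchIn (inl σ x) (inl (delL σ x) k) ≡ inl σ (punchIn x k)
punchIn-delLˡ             (l∷ σ) zero    k       = refl
punchIn-delLˡ {suc a} {n = suc n} (l∷ σ) (suc x) zero    = refl
punchIn-delLˡ {suc a} {n = suc n} (l∷ σ) (suc x) (suc k) = cong suc (punchIn-delLˡ σ x k)
punchIn-delLˡ {n = suc n} (r∷ σ) x       k       = cong suc (punchIn-delLˡ σ x k)

punchIn-delLʳ : (σ : Shuf (suc a) b (suc n)) (x : Fin (suc a)) (k : Fin b) →
  punchIn (inl σ x) (inr (delL σ x) k) ≡ inr σ k
punchIn-delLʳ             (l∷ σ) zero    k       = refl
punchIn-delLʳ {suc a} {n = suc n} (l∷ σ) (suc x) k       = cong suc (punchIn-delLʳ σ x k)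
punchIn-delLʳ {n = suc n} (r∷ σ) x       zero    = refl
punchIn-delLʳ {n = suc n} (r∷ σ) x       (suc k) = cong suc (punchIn-delLʳ σ x k)

punchIn-delRʳ : (σ : Shuf a (suc b) (suc n)) (y : Fin (suc b)) (k : Fin b) →
  punchIn (inr σ y) (inr (delR σ y) k) ≡ inr σ (punchIn y k)
punchIn-delRʳ σ y k rewrite swap-delR σ y = punchIn-delLˡ (swap σ) y k

punchIn-delRˡ : (σ : Shuf a (suc b) (suc n)) (y : Fin (suc b)) (k : Fin a) →
  punchIn (inr σ y) (inl (delR σ y) k) ≡ inl σ k
punchIn-delRˡ σ y k = begin
  punchIn (inr σ y) (inl (delR σ y) k)
    ≡⟨ cong (λ ρ → punchIn (inr σ y) (inl ρ k)) (trans (sym (swap-swap (delR σ y))) (cong swap (swap-delR σ y))) ⟩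
  punchIn (inl (swap σ) y) (inr (delL (swap σ) y) k)
    ≡⟨ punchIn-delLʳ (swap σ) y k ⟩
  inl (swap (swap σ)) k
    ≡⟨ cong (λ ρ → inl ρ k) (swap-swap σ) ⟩
  inl σ k ∎
  where open ≡-Reasoning

-- The position of the letter is `x` plus the number of r before it, and that number is the count of
-- inversions lost with the letter.
sgn-delL : (σ : Shuf (suc a) b (suc n)) (x : Fin (suc a)) →
  sign (toℕ (inl σ x)) *ℤ sgn (delL σ x) ≡ sgn σ *ℤ sign (toℕ x)
sgn-delL (l∷ σ) zero = trans (ℤₚ.*-identityˡ _) (sym (ℤₚ.*-identityʳ _))
sgn-delL {suc a} {n = suc n} (l∷ σ) (suc x) = begin
  - s *ℤ sgn (delL σ x)       ≡⟨ ℤₚ.neg-distribˡ-* s _ ⟨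
  - (s *ℤ sgn (delL σ x))     ≡⟨ cong -_ (sgn-delL σ x) ⟩
  - (sgn σ *ℤ sign (toℕ x))   ≡⟨ ℤₚ.neg-distribʳ-* (sgn σ) _ ⟩
  sgn σ *ℤ - sign (toℕ x) ∎
  where
  open ≡-Reasoning
  s = sign (toℕ (inl σ x))
sgn-delL {a} {n = suc n} (r∷ σ) x = begin
  - s *ℤ (sign a *ℤ sgn (delL σ x))      ≡⟨ shape₁ s (sign a) _ ⟩
  - sign a *ℤ (s *ℤ sgn (delL σ x))      ≡⟨ cong (- sign a *ℤ_) (sgn-delL σ x) ⟩
  - sign a *ℤ (sgn σ *ℤ sign (toℕ x))    ≡⟨ ℤₚ.*-assoc (- sign a) _ _ ⟨
  - sign a *ℤ sgn σ *ℤ sign (toℕ x) ∎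
  where
  open ≡-Reasoning
  s = sign (toℕ (inl σ x))
  shape₁ : ∀ s a t → - s *ℤ (a *ℤ t) ≡ - a *ℤ (s *ℤ t)
  shape₁ = solve-∀

-- The position is `y` plus the number of l before the letter, while the inversions lost are the l
-- after it; together these are all `a` of them, which explains `sign a`.
sgn-delR : (σ : Shuf a (suc b) (suc n)) (y : Fin (suc b)) →
  sign (toℕ (inr σ y)) *ℤ sgn (delR σ y) ≡ sign a *ℤ sgn σ *ℤ sign (toℕ y)
sgn-delR {a} (r∷ σ) zero = begin
  + 1 *ℤ sgn σ                              ≡⟨ cong (_*ℤ sgn σ) (sign-square a) ⟨
  sign a *ℤ sign a *ℤ sgn σ                 ≡⟨ shape (sign a) (sgn σ) ⟩
  sign a *ℤ (sign a *ℤ sgn σ) *ℤ + 1 ∎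
  where
  open ≡-Reasoning
  shape : ∀ a s → a *ℤ a *ℤ s ≡ a *ℤ (a *ℤ s) *ℤ + 1
  shape = solve-∀
sgn-delR {a} {b = suc b} {n = suc n} (r∷ σ) (suc y) = begin
  - s *ℤ (sign a *ℤ sgn (delR σ y))                        ≡⟨ shape₁ s (sign a) _ ⟩
  - sign a *ℤ (s *ℤ sgn (delR σ y))                        ≡⟨ cong (- sign a *ℤ_) (sgn-delR σ y) ⟩
  - sign a *ℤ (sign a *ℤ sgn σ *ℤ sign (toℕ y))            ≡⟨ shape₂ (sign a) (sgn σ) _ ⟩
  sign a *ℤ (sign a *ℤ sgn σ) *ℤ - sign (toℕ y) ∎
  where
  open ≡-Reasoning
  s = sign (toℕ (inr σ y))
  shape₁ : ∀ s a t → - s *ℤ (a *ℤ t) ≡ - a *ℤ (s *ℤ t)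
  shape₁ = solve-∀
  shape₂ : ∀ a s y → - a *ℤ (a *ℤ s *ℤ y) ≡ a *ℤ (a *ℤ s) *ℤ - y
  shape₂ = solve-∀
sgn-delR {suc a} {n = suc n} (l∷ σ) y = begin
  - s *ℤ sgn (delR σ y)                     ≡⟨ ℤₚ.neg-distribˡ-* s _ ⟨
  - (s *ℤ sgn (delR σ y))                   ≡⟨ cong -_ (sgn-delR σ y) ⟩
  - (sign a *ℤ sgn σ *ℤ sign (toℕ y))       ≡⟨ shape (sign a) (sgn σ) _ ⟩
  - sign a *ℤ sgn σ *ℤ sign (toℕ y) ∎
  where
  open ≡-Reasoning
  s = sign (toℕ (inr σ y))
  shape : ∀ a s y → - (a *ℤ s *ℤ y) ≡ - a *ℤ s *ℤ y
  shape = solve-∀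

sumL-split : (σ : Shuf a b n) (f : Fin n → ℤ) →
  sumL (allFin n) f ≡ sumL (allFin a) (f ∘ inl σ) +ℤ sumL (allFin b) (f ∘ inr σ)
sumL-split []     f = refl
sumL-split (l∷_ {a} {b} {n} σ) f = begin
  sumL (allFin (suc n)) f                                          ≡⟨ sumL-allFin-suc n f ⟩
  f zero +ℤ sumL (allFin n) (f ∘ suc)                              ≡⟨ cong (f zero +ℤ_) (sumL-split σ (f ∘ suc)) ⟩
  f zero +ℤ (sumL (allFin a) (f ∘ suc ∘ inl σ) +ℤ rest)            ≡⟨ ℤₚ.+-assoc (f zero) _ _ ⟨
  f zero +ℤ sumL (allFin a) (f ∘ suc ∘ inl σ) +ℤ rest              ≡⟨ cong (_+ℤ rest) (sumL-allFin-suc a (f ∘ inl (l∷ σ))) ⟨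
  sumL (allFin (suc a)) (f ∘ inl (l∷ σ)) +ℤ rest ∎
  where
  open ≡-Reasoning
  rest = sumL (allFin b) (f ∘ suc ∘ inr σ)
sumL-split (r∷_ {a} {b} {n} σ) f = begin
  sumL (allFin (suc n)) f                                          ≡⟨ sumL-allFin-suc n f ⟩
  f zero +ℤ sumL (allFin n) (f ∘ suc)                              ≡⟨ cong (f zero +ℤ_) (sumL-split σ (f ∘ suc)) ⟩
  f zero +ℤ (rest +ℤ sumL (allFin b) (f ∘ suc ∘ inr σ))            ≡⟨ shape (f zero) rest _ ⟩
  rest +ℤ (f zero +ℤ sumL (allFin b) (f ∘ suc ∘ inr σ))            ≡⟨ cong (rest +ℤ_) (sumL-allFin-suc b (f ∘ inr (r∷ σ))) ⟨
  rest +ℤ sumL (allFin (suc b)) (f ∘ inr (r∷ σ)) ∎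
  where
  open ≡-Reasoning
  rest = sumL (allFin a) (f ∘ suc ∘ inl σ)
  shape : ∀ x y z → x +ℤ (y +ℤ z) ≡ y +ℤ (x +ℤ z)
  shape = solve-∀

-- Determinants of block triangular matrices

laplaceTerm : (Fin (suc m) → Fin (suc n) → ℤ) → Fin (suc n) → ℤ
laplaceTerm {m} {n} X j = sign (toℕ j) *ℤ (X zero j *ℤ detR m n (λ i k → X (suc i) (punchIn j k)))

term-zeroˡ : {X : Fin (suc m) → Fin (suc n) → ℤ} {j : Fin (suc n)} → X zero j ≡ + 0 → laplaceTerm X j ≡ + 0
term-zeroˡ {j = j} e rewrite e = ℤₚ.*-zeroʳ (sign (toℕ j))

term-zeroʳ : {X : Fin (suc m) → Fin (suc n) → ℤ} {j : Fin (suc n)} →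
  detR m n (λ i k → X (suc i) (punchIn j k)) ≡ + 0 → laplaceTerm X j ≡ + 0
term-zeroʳ {X = X} {j} e rewrite e = trans (cong (sign (toℕ j) *ℤ_) (ℤₚ.*-zeroʳ (X zero j))) (ℤₚ.*-zeroʳ (sign (toℕ j)))

Triangular : Shuf a b m → Shuf c d n → (Fin m → Fin n → ℤ) → Set
Triangular σ τ X = ∀ x y → X (inl σ x) (inr τ y) ≡ + 0

-- The `a` left rows are supported on only `c` columns, too few for an injection. In the expansion
-- along the first row every minor whose coefficient can be nonzero again has fewer left columns
-- than left rows.
detR-vanish : (σ : Shuf a b m) (τ : Shuf c d n) (X : Fin m → Fin n → ℤ) →
  Triangular σ τ X → c < a → detR m n X ≡ + 0

private
  -- The minor has lost a left column, so `c ≤ a` already gives the strict inequality for it.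
  minor-vanishL : (σ : Shuf a b m) (τ : Shuf c d (suc n)) (X : Fin (suc m) → Fin (suc n) → ℤ) →
    (∀ x y → X (suc (inl σ x)) (inr τ y) ≡ + 0) → c ≤ a → ∀ y → laplaceTerm X (inl τ y) ≡ + 0
  minor-vanishL {c = suc c} σ τ X t q y = term-zeroʳ {X = X} (detR-vanish σ (delL τ y) _
    (λ x k → trans (cong (X (suc (inl σ x))) (punchIn-delLʳ τ y k)) (t x k)) q)

  minor-vanishR : (σ : Shuf a b m) (τ : Shuf c d (suc n)) (X : Fin (suc m) → Fin (suc n) → ℤ) →
    (∀ x y → X (suc (inl σ x)) (inr τ y) ≡ + 0) → c < a → ∀ y → laplaceTerm X (inr τ y) ≡ + 0
  minor-vanishR {d = suc d} σ τ X t q y = term-zeroʳ {X = X} (detR-vanish σ (delR τ y) _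
    (λ x k → trans (cong (X (suc (inl σ x))) (punchIn-delRʳ τ y k)) (t x (punchIn y k))) q)

detR-vanish []                  τ X t ()
detR-vanish {n = zero}  (l∷ σ) τ X t q = refl
detR-vanish {n = zero}  (r∷ σ) τ X t q = refl
detR-vanish {c = c} {d} {n = suc n} (l∷ σ) τ X t (s≤s q) = trans (sumL-split τ (laplaceTerm X))
  (cong₂ _+ℤ_ (sumL-zero (allFin c) (minor-vanishL σ τ X (t ∘ suc) q))
              (sumL-zero (allFin d) (λ y → term-zeroˡ {X = X} {inr τ y} (t zero y))))
detR-vanish {c = c} {d} {n = suc n} (r∷ σ) τ X t q = trans (sumL-split τ (laplaceTerm X))
  (cong₂ _+ℤ_ (sumL-zero (allFin c) (minor-vanishL σ τ X t (ℕₚ.<⇒≤ q)))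
              (sumL-zero (allFin d) (minor-vanishR σ τ X t q)))

-- Expansion along the first row. A left row meets zeros in the right columns; for a right row the
-- left columns drop out by `minor-vanishL`. The `sign a` of `sgn-delR` is the factor by which
-- `sgn (r∷ σ)` differs from `sgn σ`. Only the left block has to be square, which keeps the
-- induction free of side conditions on `b` and `d`.
detR-block : (σ : Shuf a b m) (τ : Shuf a d n) (X : Fin m → Fin n → ℤ) → Triangular σ τ X →
  detR m n X ≡ sgn σ *ℤ sgn τ *ℤ
    (detR a a (λ x y → X (inl σ x) (inl τ y)) *ℤ detR b d (λ x y → X (inr σ x) (inr τ y)))
detR-block [] τ X t = sym (trans (ℤₚ.*-identityʳ _) (trans (ℤₚ.*-identityˡ _) (sgn-noL τ)))
detR-block {d = d} {n = suc n} (l∷_ {a} {b} {m} σ) τ X t = begin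
  sumL (allFin (suc n)) (laplaceTerm X)
    ≡⟨ sumL-split τ (laplaceTerm X) ⟩
  sumL (allFin (suc a)) (laplaceTerm X ∘ inl τ) +ℤ sumL (allFin d) (laplaceTerm X ∘ inr τ)
    ≡⟨ cong₂ _+ℤ_ (sumL-cong (allFin (suc a)) term)
         (sumL-zero (allFin d) (λ y → term-zeroˡ {X = X} {inr τ y} (t zero y))) ⟩
  sumL (allFin (suc a)) (λ y → sgn σ *ℤ sgn τ *ℤ D *ℤ laplaceTerm XL y) +ℤ + 0
    ≡⟨ trans (ℤₚ.+-identityʳ _) (sumL-*ˡ (allFin (suc a)) (sgn σ *ℤ sgn τ *ℤ D) (laplaceTerm XL)) ⟩
  sgn σ *ℤ sgn τ *ℤ D *ℤ sumL (allFin (suc a)) (laplaceTerm XL)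
    ≡⟨ shape₂ (sgn σ *ℤ sgn τ) D _ ⟩
  sgn σ *ℤ sgn τ *ℤ (sumL (allFin (suc a)) (laplaceTerm XL) *ℤ D) ∎
  where
  open ≡-Reasoning
  XL : Fin (suc a) → Fin (suc a) → ℤ
  XL x y = X (inl (l∷ σ) x) (inl τ y)
  D = detR b d (λ x y → X (suc (inr σ x)) (inr τ y))
  shape₁ : ∀ s x σ τ l r → s *ℤ (x *ℤ (σ *ℤ τ *ℤ (l *ℤ r))) ≡ s *ℤ τ *ℤ (σ *ℤ r *ℤ (x *ℤ l))
  shape₁ = solve-∀
  shape₂ : ∀ s d x → s *ℤ d *ℤ x ≡ s *ℤ (x *ℤ d)
  shape₂ = solve-∀
  shape₃ : ∀ s τ σ r z → τ *ℤ s *ℤ (σ *ℤ r *ℤ z) ≡ σ *ℤ τ *ℤ r *ℤ (s *ℤ z)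
  shape₃ = solve-∀
  term : ∀ y → laplaceTerm X (inl τ y) ≡ sgn σ *ℤ sgn τ *ℤ D *ℤ laplaceTerm XL y
  term y = begin
    s *ℤ (X zero (inl τ y) *ℤ detR m n (λ i k → X (suc i) (punchIn (inl τ y) k)))
      ≡⟨ cong (λ z → s *ℤ (X zero (inl τ y) *ℤ z)) (detR-block σ (delL τ y) _
           (λ x k → trans (cong (X (suc (inl σ x))) (punchIn-delLʳ τ y k)) (t (suc x) k))) ⟩
    s *ℤ (X zero (inl τ y) *ℤ (sgn σ *ℤ sgn (delL τ y) *ℤ (ML′ *ℤ D′)))
      ≡⟨ cong₂ (λ u v → s *ℤ (X zero (inl τ y) *ℤ (sgn σ *ℤ sgn (delL τ y) *ℤ (u *ℤ v))))
           (detR-cong a a (λ i k → cong (X (suc (inl σ i))) (punchIn-delLˡ τ y k)))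
           (detR-cong b d (λ i k → cong (X (suc (inr σ i))) (punchIn-delLʳ τ y k))) ⟩
    s *ℤ (XL zero y *ℤ (sgn σ *ℤ sgn (delL τ y) *ℤ (ML *ℤ D)))
      ≡⟨ shape₁ s (XL zero y) (sgn σ) (sgn (delL τ y)) ML D ⟩
    s *ℤ sgn (delL τ y) *ℤ (sgn σ *ℤ D *ℤ (XL zero y *ℤ ML))
      ≡⟨ cong (_*ℤ (sgn σ *ℤ D *ℤ (XL zero y *ℤ ML))) (sgn-delL τ y) ⟩
    sgn τ *ℤ sign (toℕ y) *ℤ (sgn σ *ℤ D *ℤ (XL zero y *ℤ ML))
      ≡⟨ shape₃ (sign (toℕ y)) (sgn τ) (sgn σ) D _ ⟩
    sgn σ *ℤ sgn τ *ℤ D *ℤ laplaceTerm XL y ∎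
    where
    s = sign (toℕ (inl τ y))
    ML = detR a a (λ i k → XL (suc i) (punchIn y k))
    ML′ = detR a a (λ i k → X (suc (inl σ i)) (punchIn (inl τ y) (inl (delL τ y) k)))
    D′ = detR b d (λ i k → X (suc (inr σ i)) (punchIn (inl τ y) (inr (delL τ y) k)))
detR-block {n = zero} (r∷ σ) [] X t = sym (trans (cong (sgn (r∷ σ) *ℤ + 1 *ℤ_) (ℤₚ.*-zeroʳ (+ 1)))
  (ℤₚ.*-zeroʳ (sgn (r∷ σ) *ℤ + 1)))
detR-block {d = d} {n = suc n} (r∷_ {a} {b} {m} σ) τ X t = begin
  sumL (allFin (suc n)) (laplaceTerm X)
    ≡⟨ sumL-split τ (laplaceTerm X) ⟩
  sumL (allFin a) (laplaceTerm X ∘ inl τ) +ℤ sumL (allFin d) (laplaceTerm X ∘ inr τ)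
    -- A right row that takes a left column leaves one left column too few for the `a` left rows.
    ≡⟨ cong (_+ℤ sumL (allFin d) (laplaceTerm X ∘ inr τ))
         (sumL-zero (allFin a) (minor-vanishL σ τ X t ℕₚ.≤-refl)) ⟩
  + 0 +ℤ sumL (allFin d) (laplaceTerm X ∘ inr τ)
    ≡⟨ ℤₚ.+-identityˡ _ ⟩
  sumL (allFin d) (laplaceTerm X ∘ inr τ)
    ≡⟨ expand τ t ⟩
  sign a *ℤ sgn σ *ℤ sgn τ *ℤ (DL τ *ℤ detR (suc b) d (λ x y → X (inr (r∷ σ) x) (inr τ y))) ∎
  where
  open ≡-Reasoning
  DL : ∀ {d} → Shuf a d (suc n) → ℤ
  DL τ = detR a a (λ x y → X (suc (inl σ x)) (inl τ y))
  shape₁ : ∀ s x σ τ l r → s *ℤ (x *ℤ (σ *ℤ τ *ℤ (l *ℤ r))) ≡ s *ℤ τ *ℤ (σ *ℤ l *ℤ (x *ℤ r))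
  shape₁ = solve-∀
  shape₂ : ∀ s d x → s *ℤ d *ℤ x ≡ s *ℤ (d *ℤ x)
  shape₂ = solve-∀
  shape₃ : ∀ α s τ σ l z → α *ℤ τ *ℤ s *ℤ (σ *ℤ l *ℤ z) ≡ α *ℤ σ *ℤ τ *ℤ l *ℤ (s *ℤ z)
  shape₃ = solve-∀
  expand : ∀ {d} (τ : Shuf a d (suc n)) → Triangular (r∷ σ) τ X →
    sumL (allFin d) (laplaceTerm X ∘ inr τ)
      ≡ sign a *ℤ sgn σ *ℤ sgn τ *ℤ (DL τ *ℤ detR (suc b) d (λ x y → X (inr (r∷ σ) x) (inr τ y)))
  expand {zero}  τ t = sym (trans (cong (sign a *ℤ sgn σ *ℤ sgn τ *ℤ_) (ℤₚ.*-zeroʳ (DL τ)))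
    (ℤₚ.*-zeroʳ (sign a *ℤ sgn σ *ℤ sgn τ)))
  expand {suc d} τ t = trans (sumL-cong (allFin (suc d)) term)
    (trans (sumL-*ˡ (allFin (suc d)) (sign a *ℤ sgn σ *ℤ sgn τ *ℤ DL τ) (laplaceTerm XR))
      (shape₂ (sign a *ℤ sgn σ *ℤ sgn τ) (DL τ) _))
    where
    XR : Fin (suc b) → Fin (suc d) → ℤ
    XR x y = X (inr (r∷ σ) x) (inr τ y)
    term : ∀ y → laplaceTerm X (inr τ y) ≡ sign a *ℤ sgn σ *ℤ sgn τ *ℤ DL τ *ℤ laplaceTerm XR y
    term y = begin
      s *ℤ (X zero (inr τ y) *ℤ detR m n (λ i k → X (suc i) (punchIn (inr τ y) k)))
        ≡⟨ cong (λ z → s *ℤ (X zero (inr τ y) *ℤ z)) (detR-block σ (delR τ y) _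
             (λ x k → trans (cong (X (suc (inl σ x))) (punchIn-delRʳ τ y k)) (t x (punchIn y k)))) ⟩
      s *ℤ (X zero (inr τ y) *ℤ (sgn σ *ℤ sgn (delR τ y) *ℤ (DL′ *ℤ MR′)))
        ≡⟨ cong₂ (λ u v → s *ℤ (X zero (inr τ y) *ℤ (sgn σ *ℤ sgn (delR τ y) *ℤ (u *ℤ v))))
             (detR-cong a a (λ i k → cong (X (suc (inl σ i))) (punchIn-delRˡ τ y k)))
             (detR-cong b d (λ i k → cong (X (suc (inr σ i))) (punchIn-delRʳ τ y k))) ⟩
      s *ℤ (XR zero y *ℤ (sgn σ *ℤ sgn (delR τ y) *ℤ (DL τ *ℤ MR)))
        ≡⟨ shape₁ s (XR zero y) (sgn σ) (sgn (delR τ y)) (DL τ) MR ⟩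
      s *ℤ sgn (delR τ y) *ℤ (sgn σ *ℤ DL τ *ℤ (XR zero y *ℤ MR))
        ≡⟨ cong (_*ℤ (sgn σ *ℤ DL τ *ℤ (XR zero y *ℤ MR))) (sgn-delR τ y) ⟩
      sign a *ℤ sgn τ *ℤ sign (toℕ y) *ℤ (sgn σ *ℤ DL τ *ℤ (XR zero y *ℤ MR))
        ≡⟨ shape₃ (sign a) (sign (toℕ y)) (sgn τ) (sgn σ) (DL τ) _ ⟩
      sign a *ℤ sgn σ *ℤ sgn τ *ℤ DL τ *ℤ laplaceTerm XR y ∎
      where
      s = sign (toℕ (inr τ y))
      MR = detR b d (λ i k → XR (suc i) (punchIn y k))
      DL′ = detR a a (λ i k → X (suc (inl σ i)) (punchIn (inr τ y) (inl (delR τ y) k)))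
      MR′ = detR b d (λ i k → X (suc (inr σ i)) (punchIn (inr τ y) (inr (delR τ y) k)))

-- The determinant of a CNAT

entry : (Fin m → Fin n → Bool) → Fin m → Fin n → ℤ
entry g i j = if g i j then + 1 else + 0

detG : (Fin m → Fin n → Bool) → ℤ
detG g = detR _ _ (entry g)

detG-cong : {g h : Fin m → Fin n → Bool} → (∀ i j → g i j ≡ h i j) → detG g ≡ detG h
detG-cong e = detR-cong _ _ (λ i j → cong (if_then + 1 else + 0) (e i j))

-- This is `sgn (r∷ σ) *ℤ sgn (l∷ τ)`: the row of the root precedes all `a` left rows, whereas the
-- first column, being a left one, adds no inversion.
splitSign : Sign
splitSign {a = a} σ τ = sign a *ℤ sgn σ *ℤ sgn τ

-- The root, the only dot outside both blocks, lies in a right row and a left column, in the corner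
-- that triangularity leaves free.
detG-split : (σ : Shuf a b m) (τ : Shuf c d n) (g : Fin (suc m) → Fin (suc n) → Bool) → Valid σ τ g →
  a ≡ suc c → detG g ≡ splitSign σ τ *ℤ (detG (leftSub σ τ g) *ℤ detG (rightSub σ τ g))
detG-split σ τ g V refl = detR-block (r∷ σ) (l∷ τ) (entry g) tri
  where
  tri : Triangular (r∷ σ) (l∷ τ) (entry g)
  tri x y with g (inl (r∷ σ) x) (inr (l∷ τ) y) in e
  ... | false = refl
  ... | true with Valid.closed V _ _ e
  ... | inj₂ s = case trans (sym (side-inl (r∷ σ) x)) (trans s (side-inr (l∷ τ) y)) of λ ()

±1 : ℤ → Set
±1 x = x ≡ + 1 ⊎ x ≡ -[1+ 0 ]

±1-* : ∀ {x y} → ±1 x → ±1 y → ±1 (x *ℤ y)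
±1-* (inj₁ refl) (inj₁ refl) = inj₁ refl
±1-* (inj₁ refl) (inj₂ refl) = inj₂ refl
±1-* (inj₂ refl) (inj₁ refl) = inj₂ refl
±1-* (inj₂ refl) (inj₂ refl) = inj₁ refl

±1-sign : ∀ n → ±1 (sign n)
±1-sign zero = inj₁ refl
±1-sign (suc n) with ±1-sign n
... | inj₁ e = inj₂ (cong -_ e)
... | inj₂ e = inj₁ (cong -_ e)

±1-sgn : (σ : Shuf a b n) → ±1 (sgn σ)
±1-sgn []              = inj₁ refl
±1-sgn (l∷ σ)          = ±1-sgn σ
±1-sgn (r∷_ {a = a} σ) = ±1-* (±1-sign a) (±1-sgn σ)

detG-±1 : (g : Fin m → Fin n → Bool) → IsCNAT g → ±1 (detG g)
detG-±1 g C = proj₂ (IsCNAT-ind (λ {m} {n} g → m ≡ n × ±1 (detG g)) leaf node g C)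
  where
  leaf : (g : Fin 1 → Fin 1 → Bool) → IsCNAT g → 1 ≡ 1 × ±1 (detG g)
  leaf g C with IsCNAT.root C
  ... | zero , zero , _ , e rewrite e = refl , inj₁ refl
  node : ∀ {a b c d m n} (σ : Shuf a b m) (τ : Shuf c d n) g → Valid σ τ g →
    a ≡ suc c × ±1 (detG (leftSub σ τ g)) → suc b ≡ d × ±1 (detG (rightSub σ τ g)) →
    suc m ≡ suc n × ±1 (detG g)
  node {a} σ τ g V (r , p) (r′ , q) = split-square σ τ r r′ ,
    subst ±1 (sym (detG-split σ τ g V r)) (±1-* (±1-* (±1-* (±1-sign a) (±1-sgn σ)) (±1-sgn τ)) (±1-* p q))

detWeight : Weight
detWeight g = detG (toGrid g)

detWeight-mult : Multiplicative detWeight splitSign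
detWeight-mult {a} {b} {c} {d} σ τ L R@(r₀ ∷ R′) p _ = trans
  (detG-split σ τ (toGrid (join σ τ L R)) (join-valid σ τ L r₀ R′) (IsCNAT-square (toGrid L) (does⁻ (isCNAT? (toGrid L)) p)))
  (cong₂ (λ x y → splitSign σ τ *ℤ (x *ℤ y))
    (detG-cong (join-ll σ τ L r₀ R′)) (detG-cong (join-rr σ τ L r₀ R′)))

-- The signed recursion

not-CNAT : (g : Vec (Vec Bool n) m) → ¬ IsCNAT (toGrid g) → isCNATᵛ g ≡ false
not-CNAT g ¬C with isCNATᵛ g in e
... | false = refl
... | true  = ⊥-elim (¬C (does⁻ (isCNAT? (toGrid g)) e))

total-≢ : (w : Weight) → m ≢ n → total w m n ≡ + 0
total-≢ {m} {n} w m≢n = sumL-zero (grids m n) (λ g →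
  cong (λ x → ⟦ x ⟧ *ℤ w g) (not-CNAT g (λ C → m≢n (IsCNAT-square (toGrid g) C))))

total-zero : (w : Weight) (n : ℕ) → total w 0 n ≡ + 0
total-zero w n = sumL-zero (grids 0 n) (λ g →
  cong (λ x → ⟦ x ⟧ *ℤ w g) (not-CNAT g (λ C → case proj₁ (IsCNAT.root C) of λ ())))

unitWeight : Weight
unitWeight g = + 1

-- Opaque because unification would otherwise unfold the enumeration of all grids.
opaque
  N W : ℕ → ℕ → ℤ
  N = total unitWeight
  W = total detWeight

opaque
  unfolding N W

  N-total : ∀ m n → N m n ≡ total unitWeight m n
  N-total m n = refl

  W-total : ∀ m n → W m n ≡ total detWeight m n
  W-total m n = refl

  -- Found by evaluation: the only tree of size 2 has all cells dotted except the last, with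
  -- determinant -1.
  W₂₂ : W 2 2 ≡ - N 1 1
  W₂₂ = refl

N-≢ : m ≢ n → N m n ≡ + 0
N-≢ {m} {n} m≢n = trans (N-total m n) (total-≢ unitWeight m≢n)

W-≢ : m ≢ n → W m n ≡ + 0
W-≢ {m} {n} m≢n = trans (W-total m n) (total-≢ detWeight m≢n)

-- In `plainSum` the value `h a b` occurs with the binomial coefficient of `n` over `a`, in
-- `signedSum` with the Gaussian binomial coefficient at q = -1.
signedSum plainSum : ℕ → (ℕ → ℕ → ℤ) → ℤ
signedSum n h = sumL (shufs n) (λ (a , b , σ) → sgn σ *ℤ h a b)
plainSum  n h = sumL (shufs n) (λ (a , b , _) → h a b)

plainSum-cong : ∀ n {h k : ℕ → ℕ → ℤ} → (∀ a b → a + b ≡ n → h a b ≡ k a b) → plainSum n h ≡ plainSum n k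
plainSum-cong n e = sumL-cong (shufs n) (λ (a , b , σ) → e a b (shuf-size σ))

-- Pascal's rule.
plainSum-suc : ∀ n (h : ℕ → ℕ → ℤ) →
  plainSum (suc n) h ≡ plainSum n (λ a b → h (suc a) b +ℤ h a (suc b))
plainSum-suc n h = trans (sumL-shufs-suc n _)
  (sym (sumL-+ (shufs n) (λ (a , b , _) → h (suc a) b) (λ (a , b , _) → h a (suc b))))

plainSum-*ˡ : ∀ n (c : ℤ) (h : ℕ → ℕ → ℤ) → plainSum n (λ a b → c *ℤ h a b) ≡ c *ℤ plainSum n h
plainSum-*ˡ n c h = sumL-*ˡ (shufs n) c (λ (a , b , _) → h a b)

-- Exchanging the first two letters l r and r l is a sign-reversing involution.
signedSum-2+ : ∀ n (h : ℕ → ℕ → ℤ) →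
  signedSum (suc (suc n)) h ≡ signedSum n (λ a b → h (suc (suc a)) b +ℤ h a (suc (suc b)))
signedSum-2+ n h = begin
  signedSum (suc (suc n)) h
    ≡⟨ trans (sumL-shufs-suc (suc n) _) (cong₂ _+ℤ_ (sumL-shufs-suc n _) (sumL-shufs-suc n _)) ⟩
  (sumL (shufs n) ll +ℤ sumL (shufs n) lr) +ℤ (sumL (shufs n) rl +ℤ sumL (shufs n) rr)
    ≡⟨ cong₂ _+ℤ_ (sumL-+ (shufs n) ll lr) (sumL-+ (shufs n) rl rr) ⟨
  sumL (shufs n) (λ x → ll x +ℤ lr x) +ℤ sumL (shufs n) (λ x → rl x +ℤ rr x)
    ≡⟨ sumL-+ (shufs n) (λ x → ll x +ℤ lr x) (λ x → rl x +ℤ rr x) ⟨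
  sumL (shufs n) (λ x → ll x +ℤ lr x +ℤ (rl x +ℤ rr x))
    ≡⟨ sumL-cong (shufs n) (λ (a , b , σ) → trans
         (shape (sgn σ) (sign a) (h (suc (suc a)) b) (h (suc a) (suc b)) (h a (suc (suc b))))
         (cong (λ x → sgn σ *ℤ (h (suc (suc a)) b +ℤ x *ℤ h a (suc (suc b)))) (sign-square a))) ⟩
  sumL (shufs n) (λ (a , b , σ) → sgn σ *ℤ (h (suc (suc a)) b +ℤ + 1 *ℤ h a (suc (suc b))))
    ≡⟨ sumL-cong (shufs n) (λ (a , b , σ) →
         cong (λ x → sgn σ *ℤ (h (suc (suc a)) b +ℤ x)) (ℤₚ.*-identityˡ (h a (suc (suc b))))) ⟩
  signedSum n (λ a b → h (suc (suc a)) b +ℤ h a (suc (suc b))) ∎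
  where
  open ≡-Reasoning
  ll lr rl rr : AnyShuf n → ℤ
  ll (a , b , σ) = sgn (l∷ l∷ σ) *ℤ h (suc (suc a)) b
  lr (a , b , σ) = sgn (l∷ r∷ σ) *ℤ h (suc a) (suc b)
  rl (a , b , σ) = sgn (r∷ l∷ σ) *ℤ h (suc a) (suc b)
  rr (a , b , σ) = sgn (r∷ r∷ σ) *ℤ h a (suc (suc b))
  shape : ∀ s α x y z → s *ℤ x +ℤ α *ℤ s *ℤ y +ℤ (- α *ℤ s *ℤ y +ℤ α *ℤ (α *ℤ s) *ℤ z)
    ≡ s *ℤ (x +ℤ α *ℤ α *ℤ z)
  shape = solve-∀

double : ℕ → ℕ
double zero    = zero
double (suc n) = suc (suc (double n))

signedSum-even : ∀ q (h : ℕ → ℕ → ℤ) →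
  signedSum (double q) h ≡ plainSum q (λ a b → h (double a) (double b))
signedSum-even zero    h = cong (_+ℤ + 0) (ℤₚ.*-identityˡ (h 0 0))
signedSum-even (suc q) h = trans (signedSum-2+ (double q) h)
  (trans (signedSum-even q _) (sym (plainSum-suc q (λ a b → h (double a) (double b)))))

-- The unpaired last letter costs no sign, as an even number of r precedes it.
signedSum-odd : ∀ q (h : ℕ → ℕ → ℤ) → signedSum (suc (double q)) h ≡
  plainSum q (λ a b → h (suc (double a)) (double b) +ℤ h (double a) (suc (double b)))
signedSum-odd zero    h = shape (h 1 0) (h 0 1)
  where
  shape : ∀ x y → + 1 *ℤ x +ℤ (+ 1 *ℤ y +ℤ + 0) ≡ x +ℤ y +ℤ + 0
  shape = solve-∀
signedSum-odd (suc q) h = trans (signedSum-2+ (suc (double q)) h)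
  (trans (signedSum-odd q _) (trans
    (plainSum-cong q (λ a b _ → shape (h (suc (suc (suc (double a)))) (double b)) _ _ _))
    (sym (plainSum-suc q (λ a b → h (suc (double a)) (double b) +ℤ h (double a) (suc (double b)))))))
  where
  shape : ∀ x y z w → x +ℤ y +ℤ (z +ℤ w) ≡ x +ℤ z +ℤ (y +ℤ w)
  shape = solve-∀

-- Evaluation of the signed recursion

wTerm : ℕ → ℕ → ℕ → ℕ → ℤ
wTerm a b c d = sign a *ℤ (W a (suc c) *ℤ W (suc b) d)

opaque
  unfolding N W

  N-rec : 0 < m + n → N (suc m) (suc n) ≡
    plainSum m (λ a b → plainSum n (λ c d → N a (suc c) *ℤ N (suc b) d))
  N-rec {m} {n} big = trans (total-rec {w = unitWeight} {e = λ _ _ → + 1} (λ _ _ _ _ _ _ → refl) {m} {n} big)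
    (sumL-cong (shufs m) (λ (a , b , _) → sumL-cong (shufs n) (λ (c , d , _) →
      ℤₚ.*-identityˡ (N a (suc c) *ℤ N (suc b) d))))

  W-rec : 0 < m + n → W (suc m) (suc n) ≡ signedSum m (λ a b → signedSum n (wTerm a b))
  W-rec {m} {n} big = trans (total-rec {w = detWeight} {e = splitSign} detWeight-mult {m} {n} big)
    (sumL-cong (shufs m) (λ (a , b , σ) → trans
      (sumL-cong (shufs n) (λ (c , d , τ) → shape (sign a) (sgn σ) (sgn τ) (W a (suc c) *ℤ W (suc b) d)))
      (sumL-*ˡ (shufs n) (sgn σ) (λ (c , d , τ) → sgn τ *ℤ wTerm a b c d))))
    where
    shape : ∀ α s t x → α *ℤ s *ℤ t *ℤ x ≡ s *ℤ (t *ℤ (α *ℤ x))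
    shape = solve-∀

even≢odd : ∀ a c → double a ≢ suc (double c)
even≢odd (suc a) (suc c) e = even≢odd a c (ℕₚ.suc-injective (ℕₚ.suc-injective e))

wTerm-zeroˡ : ∀ a b c d → W a (suc c) ≡ + 0 → wTerm a b c d ≡ + 0
wTerm-zeroˡ a b c d e = trans (cong (λ x → sign a *ℤ (x *ℤ W (suc b) d)) e) (ℤₚ.*-zeroʳ (sign a))

wTerm-zeroʳ : ∀ a b c d → W (suc b) d ≡ + 0 → wTerm a b c d ≡ + 0
wTerm-zeroʳ a b c d e = trans (cong (λ x → sign a *ℤ (W a (suc c) *ℤ x)) e)
  (trans (cong (sign a *ℤ_) (ℤₚ.*-zeroʳ (W a (suc c)))) (ℤₚ.*-zeroʳ (sign a)))

-- Both shuffles have even length, so only doubled letters survive. The left subtree then has an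
-- even number of rows and, with the first column added, an odd number of columns. The 1 by 1 grid,
-- where the value is 1, is excluded.
W-odd : ∀ a c → 0 < double a + double c → W (suc (double a)) (suc (double c)) ≡ + 0
W-odd a c big = trans (W-rec {double a} {double c} big)
  (trans (signedSum-even a (λ a b → signedSum (double c) (wTerm a b)))
  (sumL-zero (shufs a) (λ (a , b , _) → trans (signedSum-even c (wTerm (double a) (double b))) (sumL-zero (shufs c) (λ (c , d , _) →
    wTerm-zeroˡ (double a) (double b) (double c) (double d) (W-≢ (even≢odd a c)))))))

double-+-pos : ∀ a c → 0 < a + c → 0 < double a + double c
double-+-pos (suc a) c       _ = s≤s z≤n
double-+-pos zero    (suc c) _ = s≤s z≤n

-- Both factors have odd sides, so `W-odd` makes one of them vanish unless both are single cells;
-- positivity rules that out.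
W-odd-product : ∀ a b c d → 0 < (a + b) + (c + d) →
  wTerm (suc (double a)) (double b) (double c) (suc (double d)) ≡ + 0
W-odd-product zero b zero d p = wTerm-zeroʳ 1 (double b) 0 (suc (double d)) (W-odd b d (double-+-pos b d p))
W-odd-product (suc a) b c d p =
  wTerm-zeroˡ (suc (double (suc a))) (double b) (double c) (suc (double d)) (W-odd (suc a) c (s≤s z≤n))
W-odd-product zero b (suc c) d p =
  wTerm-zeroˡ 1 (double b) (double (suc c)) (suc (double d)) (W-odd zero (suc c) (s≤s z≤n))

sign-+ : ∀ a b → sign (a + b) ≡ sign a *ℤ sign b
sign-+ zero    b = sym (ℤₚ.*-identityˡ _)
sign-+ (suc a) b = trans (cong -_ (sign-+ a b)) (ℤₚ.neg-distribˡ-* (sign a) (sign b))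

sign-double : ∀ a → sign (double a) ≡ + 1
sign-double zero    = refl
sign-double (suc a) = trans (ℤₚ.neg-involutive _) (sign-double a)

-- Both shuffles have odd length, and the sides of their last letters give four cases. Two make the
-- left subtree non-square; last row left and last column right makes both subtrees odd. There
-- remains last row right and last column left, with even subtrees: `sign (double a)` is 1 and the
-- induction hypotheses contribute the exponents `a` and `b + 1`, whose sum is always `q + 1`.
W-even : ∀ k a c → a + c ≤ k → W (double a) (double c) ≡ sign a *ℤ N a c
W-even _ zero c _ = trans (W-total 0 (double c)) (trans (total-zero detWeight (double c))
  (sym (trans (ℤₚ.*-identityˡ (N 0 c)) (trans (N-total 0 c) (total-zero unitWeight c)))))
W-even _ (suc a) zero _ = trans (W-≢ {double (suc a)} {0} (λ ()))
  (sym (trans (cong (sign (suc a) *ℤ_) (N-≢ {suc a} {0} (λ ()))) (ℤₚ.*-zeroʳ (sign (suc a)))))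
-- For `q + r = 0` the tree has two single cells as subtrees, so the odd product does not vanish,
-- and `N-rec` does not reach the 1 by 1 grid; this case is `W₂₂`.
W-even (suc k) (suc q) (suc r) (s≤s le) with 1 ℕ.≤? q + r
W-even _ (suc zero) (suc zero) _ | no _ = trans W₂₂ (sym (ℤₚ.-1*i≡-i (N 1 1)))
W-even _ (suc (suc q)) (suc r) _ | no ¬p = ⊥-elim (¬p (s≤s z≤n))
W-even _ (suc zero) (suc (suc r)) _ | no ¬p = ⊥-elim (¬p (s≤s z≤n))
W-even (suc k) (suc q) (suc r) (s≤s le) | yes big = begin
  W (double (suc q)) (double (suc r))
    ≡⟨ W-rec {suc (double q)} {suc (double r)} (s≤s z≤n) ⟩
  signedSum (suc (double q)) (λ a b → signedSum (suc (double r)) (wTerm a b))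
    ≡⟨ signedSum-odd q (λ a b → signedSum (suc (double r)) (wTerm a b)) ⟩
  plainSum q (λ a b → signedSum (suc (double r)) (wTerm (suc (double a)) (double b))
                   +ℤ signedSum (suc (double r)) (wTerm (double a) (suc (double b))))
    ≡⟨ plainSum-cong q (λ a b a+b → trans (cong₂ _+ℤ_ (vanish a b a+b) (survive a b a+b)) (ℤₚ.+-identityˡ _)) ⟩
  plainSum q (λ a b → sign (suc q) *ℤ plainSum r (λ c d → N a (suc c) *ℤ N (suc b) d))
    ≡⟨ plainSum-*ˡ q (sign (suc q)) (λ a b → plainSum r (λ c d → N a (suc c) *ℤ N (suc b) d)) ⟩
  sign (suc q) *ℤ plainSum q (λ a b → plainSum r (λ c d → N a (suc c) *ℤ N (suc b) d))
    ≡⟨ cong (sign (suc q) *ℤ_) (N-rec big) ⟨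
  sign (suc q) *ℤ N (suc q) (suc r) ∎
  where
  open ≡-Reasoning
  vanish : ∀ a b → a + b ≡ q → signedSum (suc (double r)) (wTerm (suc (double a)) (double b)) ≡ + 0
  vanish a b a+b = trans (signedSum-odd r (wTerm (suc (double a)) (double b))) (sumL-zero (shufs r) (λ (c , d , τ) → cong₂ _+ℤ_
    (wTerm-zeroˡ (suc (double a)) (double b) (suc (double c)) (double d)
      (W-≢ (λ e → even≢odd (suc c) a (sym e))))
    (W-odd-product a b c d (subst₂ (λ x y → 0 < x + y) (sym a+b) (sym (shuf-size τ)) big))))
  survive : ∀ a b → a + b ≡ q → signedSum (suc (double r)) (wTerm (double a) (suc (double b)))
    ≡ sign (suc q) *ℤ plainSum r (λ c d → N a (suc c) *ℤ N (suc b) d)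
  survive a b a+b = begin
    signedSum (suc (double r)) (wTerm (double a) (suc (double b)))
      ≡⟨ signedSum-odd r (wTerm (double a) (suc (double b))) ⟩
    plainSum r (λ c d → wTerm (double a) (suc (double b)) (suc (double c)) (double d)
                     +ℤ wTerm (double a) (suc (double b)) (double c) (suc (double d)))
      ≡⟨ plainSum-cong r (λ c d c+d → trans (cong₂ _+ℤ_ (main c d c+d)
           (wTerm-zeroˡ (double a) (suc (double b)) (double c) (suc (double d))
             (W-≢ (even≢odd a c)))) (ℤₚ.+-identityʳ _)) ⟩
    plainSum r (λ c d → sign (suc q) *ℤ (N a (suc c) *ℤ N (suc b) d))
      ≡⟨ plainSum-*ˡ r (sign (suc q)) (λ c d → N a (suc c) *ℤ N (suc b) d) ⟩
    sign (suc q) *ℤ plainSum r (λ c d → N a (suc c) *ℤ N (suc b) d) ∎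
    where
    shape : ∀ s t x y → + 1 *ℤ (s *ℤ x *ℤ (- t *ℤ y)) ≡ - (s *ℤ t) *ℤ (x *ℤ y)
    shape = solve-∀
    main : ∀ c d → c + d ≡ r →
      wTerm (double a) (suc (double b)) (suc (double c)) (double d) ≡ sign (suc q) *ℤ (N a (suc c) *ℤ N (suc b) d)
    main c d c+d = begin
      sign (double a) *ℤ (W (double a) (double (suc c)) *ℤ W (double (suc b)) (double d))
        ≡⟨ cong₂ _*ℤ_ (sign-double a) (cong₂ _*ℤ_ (W-even k a (suc c) le₁) (W-even k (suc b) d le₂)) ⟩
      + 1 *ℤ (sign a *ℤ N a (suc c) *ℤ (- sign b *ℤ N (suc b) d))
        ≡⟨ shape (sign a) (sign b) (N a (suc c)) (N (suc b) d) ⟩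
      - (sign a *ℤ sign b) *ℤ (N a (suc c) *ℤ N (suc b) d)
        ≡⟨ cong (λ x → - x *ℤ (N a (suc c) *ℤ N (suc b) d)) (trans (sym (sign-+ a b)) (cong sign a+b)) ⟩
      sign (suc q) *ℤ (N a (suc c) *ℤ N (suc b) d) ∎
      where
      le₁ : a + suc c ≤ k
      le₁ = ℕₚ.≤-trans (ℕₚ.+-mono-≤ (ℕₚ.m+n≤o⇒m≤o a (ℕₚ.≤-reflexive a+b))
        (s≤s (ℕₚ.m+n≤o⇒m≤o c (ℕₚ.≤-reflexive c+d)))) le
      le₂ : suc b + d ≤ k
      le₂ = ℕₚ.≤-trans (s≤s (ℕₚ.+-mono-≤ (ℕₚ.m+n≤o⇒n≤o a (ℕₚ.≤-reflexive a+b))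
        (ℕₚ.m+n≤o⇒n≤o c (ℕₚ.≤-reflexive c+d)))) (subst (_≤ k) (ℕₚ.+-suc q r) le)

-- Equivalence with the Boolean definitions

-- Generalised to `List.tabulate f`, because the tail of `allFin (suc n)` is a tabulation but not an
-- `allFin`.
any⁻ : ∀ {n} {X : Set} (p : X → Bool) (f : Fin n → X) → any p (List.tabulate f) ≡ true → ∃ λ i → p (f i) ≡ true
any⁻ {suc n} p f e with p (f zero) in q
... | true  = zero , q
... | false = let i , r = any⁻ p (f ∘ suc) e in suc i , r

any⁺ : ∀ {n} {X : Set} (p : X → Bool) (f : Fin n → X) i → p (f i) ≡ true → any p (List.tabulate f) ≡ true
any⁺ p f zero    e rewrite e = refl
any⁺ p f (suc i) e with p (f zero)
... | true  = refl
... | false = any⁺ p (f ∘ suc) i e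

all⁻ : ∀ {n} {X : Set} (p : X → Bool) (f : Fin n → X) → all p (List.tabulate f) ≡ true → ∀ i → p (f i) ≡ true
all⁻ p f e zero    = proj₁ (∧-true⁻ e)
all⁻ p f e (suc i) = all⁻ p (f ∘ suc) (proj₂ (∧-true⁻ {p (f zero)} e)) i

all⁺ : ∀ {n} {X : Set} (p : X → Bool) (f : Fin n → X) → (∀ i → p (f i) ≡ true) → all p (List.tabulate f) ≡ true
all⁺ {zero}  p f e = refl
all⁺ {suc n} p f e = ∧-true⁺ (e zero) (all⁺ p (f ∘ suc) (e ∘ suc))

isYes⁻ : {P : Set} (p : Dec P) → ⌊ p ⌋ ≡ true → P
isYes⁻ (yes p) _ = p

isYes⁺ : {P : Set} (p : Dec P) → P → ⌊ p ⌋ ≡ true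
isYes⁺ (yes _) _ = refl
isYes⁺ (no ¬p) p = ⊥-elim (¬p p)

filtered⁻ : {P : Fin n → Set} (P? : ∀ i → Dec (P i)) (p : Fin n → Bool) →
  any (λ i → ⌊ P? i ⌋ ∧ p i) (allFin n) ≡ true → ∃ λ i → P i × p i ≡ true
filtered⁻ P? p e = let i , q = any⁻ (λ i → ⌊ P? i ⌋ ∧ p i) id e
                       r , s = ∧-true⁻ {⌊ P? i ⌋} q in i , isYes⁻ (P? i) r , s

filtered⁺ : {P : Fin n → Set} (P? : ∀ i → Dec (P i)) (p : Fin n → Bool) →
  (∃ λ i → P i × p i ≡ true) → any (λ i → ⌊ P? i ⌋ ∧ p i) (allFin n) ≡ true
filtered⁺ P? p (i , r , s) = any⁺ (λ i → ⌊ P? i ⌋ ∧ p i) id i (∧-true⁺ (isYes⁺ (P? i) r) s)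

module _ {n : ℕ} (g : Grid n) where

  above⁻ : ∀ i j → dotAbove g i j ≡ true → Above g i j
  above⁻ i j = filtered⁻ (λ i' → i' <? i) (λ i' → g i' j)

  above⁺ : ∀ i j → Above g i j → dotAbove g i j ≡ true
  above⁺ i j = filtered⁺ (λ i' → i' <? i) (λ i' → g i' j)

  left⁻ : ∀ i j → dotLeft g i j ≡ true → Left g i j
  left⁻ i j = filtered⁻ (λ j' → j' <? j) (λ j' → g i j')

  left⁺ : ∀ i j → Left g i j → dotLeft g i j ≡ true
  left⁺ i j = filtered⁺ (λ j' → j' <? j) (λ j' → g i j')

  below⁻ : ∀ i j → dotBelow g i j ≡ true → Below g i j
  below⁻ i j = filtered⁻ (λ i' → i <? i') (λ i' → g i' j)

  below⁺ : ∀ i j → Below g i j → dotBelow g i j ≡ true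
  below⁺ i j = filtered⁺ (λ i' → i <? i') (λ i' → g i' j)

  right⁻ : ∀ i j → dotRight g i j ≡ true → Right g i j
  right⁻ i j = filtered⁻ (λ j' → j <? j') (λ j' → g i j')

  right⁺ : ∀ i j → Right g i j → dotRight g i j ≡ true
  right⁺ i j = filtered⁺ (λ j' → j <? j') (λ j' → g i j')

isRootCell⁻ : ∀ {n} (g : Grid n) i j → isRootCell g i j ≡ true → Root g i j
isRootCell⁻ g zero zero _ = refl , refl

isRootCell⁺ : ∀ {n} (g : Grid n) i j → Root g i j → isRootCell g i j ≡ true
isRootCell⁺ g zero zero _ = refl

module _ {n : ℕ} (g : Grid n) where

  private
    parentCell completeCell : Fin n → Fin n → Bool
    parentCell   i j = not (g i j) ∨ isRootCell g i j ∨ (dotAbove g i j xor dotLeft g i j)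
    completeCell i j = not (g i j) ∨ isInternal g i j ∨ isLeaf g i j

    cells⁻ : (p : Fin n → Fin n → Bool) → all (λ i → all (p i) (allFin n)) (allFin n) ≡ true →
      ∀ i j → p i j ≡ true
    cells⁻ p e i = all⁻ (p i) id (all⁻ (λ i → all (p i) (allFin n)) id e i)

    cells⁺ : (p : Fin n → Fin n → Bool) → (∀ i j → p i j ≡ true) →
      all (λ i → all (p i) (allFin n)) (allFin n) ≡ true
    cells⁺ p e = all⁺ (λ i → all (p i) (allFin n)) id (λ i → all⁺ (p i) id (e i))

    parentCell⁻ : ∀ {i j} → parentCell i j ≡ true → g i j ≡ true →
      Root g i j ⊎ (dotAbove g i j xor dotLeft g i j) ≡ true
    parentCell⁻ {i} {j} e q rewrite q with isRootCell g i j in r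
    ... | true  = inj₁ (isRootCell⁻ g i j r)
    ... | false = inj₂ e

    completeCell⁻ : ∀ {i j} → completeCell i j ≡ true → g i j ≡ true → dotBelow g i j ≡ dotRight g i j
    completeCell⁻ {i} {j} e q rewrite q with dotBelow g i j | dotRight g i j
    ... | true  | true  = refl
    ... | false | false = refl

  isCNAT⁻ : isCNAT g ≡ true → IsCNAT g
  isCNAT⁻ e = record
    { root       = let i , q = any⁻ (λ i → any (λ j → isRootCell g i j ∧ g i j) (allFin n)) id eroot
                       j , r = any⁻ (λ j → isRootCell g i j ∧ g i j) id q
                       s , t = ∧-true⁻ {isRootCell g i j} r
                   in i , j , isRootCell⁻ g i j s , t
    ; parent     = λ i j q → par i j (parentCell⁻ (cells⁻ parentCell eparent i j) q)
    ; ¬both      = λ i j q u l → both i j u l (parentCell⁻ (cells⁻ parentCell eparent i j) q)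
    ; row        = λ i → any⁻ (g i) id (all⁻ (λ i → any (g i) (allFin n)) id erows i)
    ; col        = λ j → any⁻ (λ i → g i j) id (all⁻ (λ j → any (λ i → g i j) (allFin n)) id ecols j)
    ; belowRight = λ i j q u → right⁻ g i j
        (trans (sym (completeCell⁻ (cells⁻ completeCell ecomplete i j) q)) (below⁺ g i j u))
    ; rightBelow = λ i j q u → below⁻ g i j
        (trans (completeCell⁻ (cells⁻ completeCell ecomplete i j) q) (right⁺ g i j u))
    }
    where
    enat      = proj₁ (∧-true⁻ {isNAT g} e)
    ecomplete = proj₂ (∧-true⁻ {isNAT g} e)
    eroot     = proj₁ (∧-true⁻ {rootDotted g} enat)
    enat′     = proj₂ (∧-true⁻ {rootDotted g} enat)
    eparent   = proj₁ (∧-true⁻ {parentCondition g} enat′)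
    enat″     = proj₂ (∧-true⁻ {parentCondition g} enat′)
    erows     = proj₁ (∧-true⁻ {rowsNonEmpty g} enat″)
    ecols     = proj₂ (∧-true⁻ {rowsNonEmpty g} enat″)

    par : ∀ i j → Root g i j ⊎ (dotAbove g i j xor dotLeft g i j) ≡ true →
      Root g i j ⊎ (Above g i j ⊎ Left g i j)
    par i j (inj₁ r) = inj₁ r
    par i j (inj₂ x) with dotAbove g i j in a | dotLeft g i j in l
    ... | true  | _    = inj₂ (inj₁ (above⁻ g i j a))
    ... | false | true = inj₂ (inj₂ (left⁻ g i j l))

    both : ∀ i j → Above g i j → Left g i j →
      Root g i j ⊎ (dotAbove g i j xor dotLeft g i j) ≡ true → ⊥
    both i j (i' , u , _) l (inj₁ (r , _)) = ℕₚ.n≮0 (subst (toℕ i' <_) r u)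
    both i j u l (inj₂ x) rewrite above⁺ g i j u | left⁺ g i j l = case x of λ ()

  module _ (C : IsCNAT g) where
    open IsCNAT C

    isCNAT⁺ : isCNAT g ≡ true
    isCNAT⁺ = ∧-true⁺ (∧-true⁺ eroot (∧-true⁺ (cells⁺ parentCell cellP) (∧-true⁺ erows ecols)))
      (cells⁺ completeCell cellC)
      where
      eroot : rootDotted g ≡ true
      eroot = let i , j , r , e = root in
        any⁺ (λ i → any (λ j → isRootCell g i j ∧ g i j) (allFin n)) id i
          (any⁺ (λ j → isRootCell g i j ∧ g i j) id j (∧-true⁺ (isRootCell⁺ g i j r) e))
      erows : rowsNonEmpty g ≡ true
      erows = all⁺ (λ i → any (g i) (allFin n)) id λ i → let j , e = row i in any⁺ (g i) id j e
      ecols : colsNonEmpty g ≡ true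
      ecols = all⁺ (λ j → any (λ i → g i j) (allFin n)) id λ j → let i , e = col j in any⁺ (λ i → g i j) id i e
      cellP : ∀ i j → parentCell i j ≡ true
      cellP i j with g i j in q | isRootCell g i j in r
      ... | false | _    = refl
      ... | true  | true = refl
      ... | true  | false with dotAbove g i j in a | dotLeft g i j in l | parent i j q
      ... | true  | true  | _ = ⊥-elim (¬both i j q (above⁻ g i j a) (left⁻ g i j l))
      ... | true  | false | _ = refl
      ... | false | true  | _ = refl
      ... | false | false | inj₁ ro = case trans (sym r) (isRootCell⁺ g i j ro) of λ ()
      ... | false | false | inj₂ (inj₁ u) = case trans (sym a) (above⁺ g i j u) of λ ()
      ... | false | false | inj₂ (inj₂ u) = case trans (sym l) (left⁺ g i j u) of λ ()
      cellC : ∀ i j → completeCell i j ≡ true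
      cellC i j with g i j in q | dotBelow g i j in u | dotRight g i j in v
      ... | false | _     | _     = refl
      ... | true  | true  | true  = refl
      ... | true  | false | false = refl
      ... | true  | true  | false = case trans (sym v) (right⁺ g i j (belowRight i j q (below⁻ g i j u))) of λ ()
      ... | true  | false | true  = case trans (sym u) (below⁺ g i j (rightBelow i j q (right⁻ g i j v))) of λ ()

    -- The rightmost dot of a row has no dot to its right, hence by completeness none below. By
    -- `leaf-unique` it is the only leaf of its row, so a tree on `n` rows has `n` leaves.
    lastDot : ∀ i j → g i j ≡ true → Acc Fin._>_ j → ∃ λ j' → isLeaf g i j' ≡ true
    lastDot i j q (acc rec) with dotRight g i j in v
    ... | true  = let j' , u , q' = right⁻ g i j v in lastDot i j' q' (rec u)
    ... | false = j , leaf
      where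
      leaf : isLeaf g i j ≡ true
      leaf rewrite q | v with dotBelow g i j in u
      ... | false = refl
      ... | true  = case trans (sym v) (right⁺ g i j (belowRight i j q (below⁻ g i j u))) of λ ()

    isLeaf-dot : ∀ i j → isLeaf g i j ≡ true → g i j ≡ true × dotRight g i j ≡ false
    isLeaf-dot i j e with g i j | dotBelow g i j | dotRight g i j
    ... | true | false | false = refl , refl

    leaf-unique : ∀ i j j' → isLeaf g i j ≡ true → isLeaf g i j' ≡ true → j ≡ j'
    leaf-unique i j j' e e' with isLeaf-dot i j e | isLeaf-dot i j' e' | ℕₚ.<-cmp (toℕ j) (toℕ j')
    ... | _ , v | q , _ | tri< u _ _ = case trans (sym v) (right⁺ g i j (j' , u , q)) of λ ()
    ... | _     | _     | tri≈ _ p _ = Finₚ.toℕ-injective p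
    ... | q , _ | _ , v | tri> _ _ u = case trans (sym v) (right⁺ g i j' (j , u , q)) of λ ()

sum-if-zero : ∀ {n} {X : Set} (p : X → Bool) (f : Fin n → X) → (∀ j → p (f j) ≡ false) →
  count p (List.tabulate f) ≡ 0
sum-if-zero {zero}  p f h = refl
sum-if-zero {suc n} p f h rewrite h zero = sum-if-zero p (f ∘ suc) (h ∘ suc)

count-unique : ∀ {n} {X : Set} (p : X → Bool) (f : Fin n → X) i → p (f i) ≡ true →
  (∀ j → p (f j) ≡ true → j ≡ i) → count p (List.tabulate f) ≡ 1
count-unique p f zero e h rewrite e = cong suc (sum-if-zero p (f ∘ suc) λ j → others j)
  where
  others : ∀ j → p (f (suc j)) ≡ false
  others j with p (f (suc j)) in q
  ... | false = refl
  ... | true  = case h (suc j) q of λ ()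
count-unique p f (suc i) e h with p (f zero) in q
... | true  = case h zero q of λ ()
... | false = count-unique p (f ∘ suc) i e (λ j r → Finₚ.suc-injective (h (suc j) r))

module _ {n : ℕ} (g : Grid n) where

  countTrue-++ : (xs ys : List Bool) → countTrue g (xs ++ ys) ≡ countTrue g xs + countTrue g ys
  countTrue-++ []       ys = refl
  countTrue-++ (x ∷ xs) ys rewrite countTrue-++ xs ys =
    sym (ℕₚ.+-assoc (if x then 1 else 0) (countTrue g xs) (countTrue g ys))

  countTrue-map : {X : Set} (p : X → Bool) (xs : List X) → countTrue g (List.map p xs) ≡ count p xs
  countTrue-map p []       = refl
  countTrue-map p (x ∷ xs) = cong (λ k → (if p x then 1 else 0) + k) (countTrue-map p xs)

  countTrue-rows : ∀ {m} {X : Set} (h : X → List Bool) (f : Fin m → X) →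
    (∀ i → countTrue g (h (f i)) ≡ 1) → countTrue g (concatMap h (List.tabulate f)) ≡ m
  countTrue-rows {zero}  h f e = refl
  countTrue-rows {suc m} h f e = trans (countTrue-++ (h (f zero)) _)
    (cong₂ _+_ (e zero) (countTrue-rows h (f ∘ suc) (e ∘ suc)))

  numLeaves-size : IsCNAT g → numLeaves g ≡ n
  numLeaves-size C = countTrue-rows (λ i → List.map (isLeaf g i) (allFin n)) id λ i →
    let j , q = IsCNAT.row C i
        k , e = lastDot g C i j q (>-wellFounded j)
    in trans (countTrue-map (isLeaf g i) (allFin n))
      (count-unique (isLeaf g i) id k e (λ j' e' → leaf-unique g C i j' k e' e))

  isCNATOfSize-does : isCNATOfSize n g ≡ does (isCNAT? g)
  isCNATOfSize-does = true-⇔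
    (λ e → does⁺ (isCNAT? g) (isCNAT⁻ g (proj₁ (∧-true⁻ {isCNAT g} e))))
    (λ e → let C = does⁻ (isCNAT? g) e in
      ∧-true⁺ (isCNAT⁺ g C) (isYes⁺ (numLeaves g ℕ.≟ n) (numLeaves-size C)))

-- Grids as functions and as vectors

module _ {X Y : Set} (_≈_ : X → X → Set) (≈-refl : ∀ {x} → x ≈ x) (φ : Y → X) where

  Respects : {Z : Set} → (Z → Z → Set) → (Z → ℤ) → Set
  Respects _~_ F = ∀ {x y} → x ~ y → F x ≡ F y

  Pointwise : ∀ k → (Fin k → X) → (Fin k → X) → Set
  Pointwise k f h = ∀ i → f i ≈ h i

  ∷-cong : ∀ {k x y} {f h : Fin k → X} → x ≈ y → Pointwise k f h → Pointwise (suc k) (x ∷ᵥ f) (y ∷ᵥ h)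
  ∷-cong p q zero    = p
  ∷-cong p q (suc i) = q i

  lookup-∷ : ∀ {k} y (v : Vec Y k) → Pointwise (suc k) (φ y ∷ᵥ (φ ∘ lookup v)) (φ ∘ lookup (y ∷ v))
  lookup-∷ y v zero    = ≈-refl
  lookup-∷ y v (suc i) = ≈-refl

  -- The functions listed by `allFuns` agree with lookups in vectors only pointwise, so the summand
  -- must respect pointwise equality. The relation is a parameter because the lemma is applied first
  -- to rows of Booleans, with equality, and then to grids of rows, with pointwise equality.
  sumL-allFuns : {xs : List X} {ys : List Y} →
    (∀ {H} → Respects _≈_ H → sumL xs H ≡ sumL ys (H ∘ φ)) →
    ∀ k {F : (Fin k → X) → ℤ} → Respects (Pointwise k) F →
    sumL (allFuns xs k) F ≡ sumL (vecs ys k) (λ v → F (λ i → φ (lookup v i)))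
  sumL-allFuns enum zero    ext = cong (_+ℤ + 0) (ext λ ())
  sumL-allFuns {xs} {ys} enum (suc k) {F} ext = begin
    sumL (allFuns xs (suc k)) F
      ≡⟨ trans (sumL-concatMap (λ x → List.map (x ∷ᵥ_) (allFuns xs k)) xs F)
           (sumL-cong xs (λ x → sumL-map (x ∷ᵥ_) (allFuns xs k) F)) ⟩
    sumL xs (λ x → sumL (allFuns xs k) (λ f → F (x ∷ᵥ f)))
      ≡⟨ sumL-cong xs (λ x → sumL-allFuns enum k {λ f → F (x ∷ᵥ f)}
           (λ e → ext (∷-cong ≈-refl e))) ⟩
    sumL xs (λ x → sumL (vecs ys k) (λ v → F (x ∷ᵥ (λ i → φ (lookup v i)))))
      ≡⟨ enum (λ e → sumL-cong (vecs ys k) (λ v → ext (∷-cong e (λ _ → ≈-refl)))) ⟩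
    sumL ys (λ y → sumL (vecs ys k) (λ v → F (φ y ∷ᵥ (λ i → φ (lookup v i)))))
      ≡⟨ sumL-cong ys (λ y → sumL-cong (vecs ys k) (λ v →
           ext (lookup-∷ y v))) ⟩
    sumL ys (λ y → sumL (vecs ys k) (λ v → F (λ i → φ (lookup (y ∷ v) i))))
      ≡⟨ sumL-vecs-suc ys k _ ⟨
    sumL (vecs ys (suc k)) (λ v → F (λ i → φ (lookup v i))) ∎
    where open ≡-Reasoning

sumL-allGrids : ∀ n {F : Grid n → ℤ} → (∀ {g h} → (∀ i j → g i j ≡ h i j) → F g ≡ F h) →
  sumL (allGrids n) F ≡ sumL (grids n n) (F ∘ toGrid)
sumL-allGrids n ext = sumL-allFuns (λ f h → ∀ j → f j ≡ h j) (λ _ → refl) lookup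
  (λ {H} e → sumL-allFuns _≡_ refl id {bits} {bits} (λ _ → refl) n {H} e) n ext

count-sumL : {X : Set} (p : X → Bool) (xs : List X) → + count p xs ≡ sumL xs (λ x → ⟦ p x ⟧)
count-sumL p []       = refl
count-sumL p (x ∷ xs) with p x
... | true  = cong (+ 1 +ℤ_) (count-sumL p xs)
... | false = trans (count-sumL p xs) (sym (ℤₚ.+-identityˡ _))

sumL-CNAT : ∀ n (u : Grid n → ℤ) → (∀ {g h} → (∀ i j → g i j ≡ h i j) → u g ≡ u h) →
  sumL (allGrids n) (λ g → ⟦ isCNATOfSize n g ⟧ *ℤ u g) ≡ sumL (grids n n) (λ g → ⟦ isCNATᵛ g ⟧ *ℤ u (toGrid g))
sumL-CNAT n u ext = trans
  (sumL-cong (allGrids n) (λ g → cong (λ x → ⟦ x ⟧ *ℤ u g) (isCNATOfSize-does g)))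
  (sumL-allGrids n (λ {g} {h} e → cong₂ (λ x y → ⟦ x ⟧ *ℤ y)
    (true-⇔ (λ p → does⁺ (isCNAT? h) (IsCNAT-ext e (does⁻ (isCNAT? g) p)))
            (λ p → does⁺ (isCNAT? g) (IsCNAT-ext (λ i j → sym (e i j)) (does⁻ (isCNAT? h) p))))
    (ext e)))

Tcount-N : ∀ n → + Tcount n ≡ N n n
Tcount-N n = trans (count-sumL (isCNATOfSize n) (allGrids n))
  (trans (sumL-cong (allGrids n) (λ g → sym (ℤₚ.*-identityʳ ⟦ isCNATOfSize n g ⟧)))
  (trans (sumL-CNAT n (λ _ → + 1) (λ _ → refl)) (sym (N-total n n))))

private
  hasDet : ∀ n → ℤ → Grid n → Bool
  hasDet n ε g = isCNATOfSize n g ∧ ⌊ det n (M g) ℤ.≟ ε ⌋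

  det-±1 : ∀ {n} (g : Grid n) → isCNATOfSize n g ≡ true → ±1 (det n (M g))
  det-±1 {n} g e = subst ±1 (sym (det-detR n (M g)))
    (detG-±1 g (does⁻ (isCNAT? g) (trans (sym (isCNATOfSize-does g)) e)))

Tdet-+ : ∀ n → + Tdet n (+ 1) +ℤ + Tdet n -[1+ 0 ] ≡ N n n
Tdet-+ n = begin
  + Tdet n (+ 1) +ℤ + Tdet n -[1+ 0 ]
    ≡⟨ cong₂ _+ℤ_ (count-sumL (hasDet n (+ 1)) (allGrids n)) (count-sumL (hasDet n -[1+ 0 ]) (allGrids n)) ⟩
  sumL (allGrids n) (λ g → ⟦ hasDet n (+ 1) g ⟧) +ℤ sumL (allGrids n) (λ g → ⟦ hasDet n -[1+ 0 ] g ⟧)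
    ≡⟨ sumL-+ (allGrids n) (λ g → ⟦ hasDet n (+ 1) g ⟧) (λ g → ⟦ hasDet n -[1+ 0 ] g ⟧) ⟨
  sumL (allGrids n) (λ g → ⟦ hasDet n (+ 1) g ⟧ +ℤ ⟦ hasDet n -[1+ 0 ] g ⟧)
    ≡⟨ sumL-cong (allGrids n) cell ⟩
  sumL (allGrids n) (λ g → ⟦ isCNATOfSize n g ⟧)
    ≡⟨ trans (sym (count-sumL (isCNATOfSize n) (allGrids n))) (Tcount-N n) ⟩
  N n n ∎
  where
  open ≡-Reasoning
  cell : ∀ g → ⟦ hasDet n (+ 1) g ⟧ +ℤ ⟦ hasDet n -[1+ 0 ] g ⟧ ≡ ⟦ isCNATOfSize n g ⟧
  cell g with isCNATOfSize n g in e
  ... | false = refl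
  ... | true with det-±1 g e
  ... | inj₁ q rewrite q = refl
  ... | inj₂ q rewrite q = refl

-- For a determinant that is 1 or -1, the indicator of 1 minus the indicator of -1 is the
-- determinant itself.
Tdet-− : ∀ n → + Tdet n (+ 1) -ℤ + Tdet n -[1+ 0 ] ≡ W n n
Tdet-− n = begin
  + Tdet n (+ 1) -ℤ + Tdet n -[1+ 0 ]
    ≡⟨ cong₂ _-ℤ_ (count-sumL (hasDet n (+ 1)) (allGrids n)) (count-sumL (hasDet n -[1+ 0 ]) (allGrids n)) ⟩
  sumL (allGrids n) (λ g → ⟦ hasDet n (+ 1) g ⟧) -ℤ sumL (allGrids n) (λ g → ⟦ hasDet n -[1+ 0 ] g ⟧)
    ≡⟨ cong (sumL (allGrids n) (λ g → ⟦ hasDet n (+ 1) g ⟧) +ℤ_) (trans (sym (ℤₚ.-1*i≡-i _))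
         (sym (sumL-*ˡ (allGrids n) -[1+ 0 ] (λ g → ⟦ hasDet n -[1+ 0 ] g ⟧)))) ⟩
  sumL (allGrids n) (λ g → ⟦ hasDet n (+ 1) g ⟧) +ℤ sumL (allGrids n) (λ g → -[1+ 0 ] *ℤ ⟦ hasDet n -[1+ 0 ] g ⟧)
    ≡⟨ sumL-+ (allGrids n) (λ g → ⟦ hasDet n (+ 1) g ⟧) (λ g → -[1+ 0 ] *ℤ ⟦ hasDet n -[1+ 0 ] g ⟧) ⟨
  sumL (allGrids n) (λ g → ⟦ hasDet n (+ 1) g ⟧ +ℤ -[1+ 0 ] *ℤ ⟦ hasDet n -[1+ 0 ] g ⟧)
    ≡⟨ sumL-cong (allGrids n) cell ⟩
  sumL (allGrids n) (λ g → ⟦ isCNATOfSize n g ⟧ *ℤ detG g)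
    ≡⟨ trans (sumL-CNAT n detG detG-cong) (sym (W-total n n)) ⟩
  W n n ∎
  where
  open ≡-Reasoning
  cell : ∀ g → ⟦ hasDet n (+ 1) g ⟧ +ℤ -[1+ 0 ] *ℤ ⟦ hasDet n -[1+ 0 ] g ⟧ ≡ ⟦ isCNATOfSize n g ⟧ *ℤ detG g
  cell g with isCNATOfSize n g in e
  ... | false = refl
  ... | true rewrite sym (det-detR n (M g)) with det-±1 g e
  ... | inj₁ q rewrite q = refl
  ... | inj₂ q rewrite q = refl

2Tdet₊ : ∀ n → + 2 *ℤ + Tdet n (+ 1) ≡ N n n +ℤ W n n
2Tdet₊ n = trans (shape (+ Tdet n (+ 1)) (+ Tdet n -[1+ 0 ])) (cong₂ _+ℤ_ (Tdet-+ n) (Tdet-− n))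
  where
  shape : ∀ x y → + 2 *ℤ x ≡ x +ℤ y +ℤ (x -ℤ y)
  shape = solve-∀

2Tdet₋ : ∀ n → + 2 *ℤ + Tdet n -[1+ 0 ] ≡ N n n -ℤ W n n
2Tdet₋ n = trans (shape (+ Tdet n (+ 1)) (+ Tdet n -[1+ 0 ])) (cong₂ _-ℤ_ (Tdet-+ n) (Tdet-− n))
  where
  shape : ∀ x y → + 2 *ℤ y ≡ x +ℤ y -ℤ (x -ℤ y)
  shape = solve-∀

double-2* : ∀ n → double n ≡ 2 * n
double-2* zero    = refl
double-2* (suc n) = cong suc (trans (cong suc (double-2* n)) (sym (ℕₚ.+-suc n (n + 0))))

W-odd-2* : ∀ q → 1 ≤ q → W (suc (2 * q)) (suc (2 * q)) ≡ + 0
W-odd-2* (suc q) _ rewrite sym (double-2* (suc q)) = W-odd (suc q) (suc q) (s≤s z≤n)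

W-even-2* : ∀ p → W (2 * p) (2 * p) ≡ sign p *ℤ + Tcount p
W-even-2* p rewrite sym (double-2* p) = trans (W-even (p + p) p p ℕₚ.≤-refl) (cong (sign p *ℤ_) (sym (Tcount-N p)))

theorem1 : ((q : ℕ) → 1 ≤ q →
    (2 * Tdet (suc (2 * q)) (+ 1) ≡ Tcount (suc (2 * q)))
    × (2 * Tdet (suc (2 * q)) -[1+ 0 ] ≡ Tcount (suc (2 * q))))
    × ((p : ℕ) → 1 ≤ p →
    (+ 2 *ℤ + Tdet (2 * p) (+ 1) ≡ + Tcount (2 * p) +ℤ sign p *ℤ + Tcount p)
    × (+ 2 *ℤ + Tdet (2 * p) -[1+ 0 ] ≡ + Tcount (2 * p) -ℤ sign p *ℤ + Tcount p))
theorem1 = odd , even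
  where
  odd : (q : ℕ) → 1 ≤ q →
    (2 * Tdet (suc (2 * q)) (+ 1) ≡ Tcount (suc (2 * q))) × (2 * Tdet (suc (2 * q)) -[1+ 0 ] ≡ Tcount (suc (2 * q)))
  odd q 1≤q =
    ℤₚ.+-injective (trans (ℤₚ.pos-* 2 (Tdet size (+ 1))) (trans (2Tdet₊ size)
      (trans (cong (N size size +ℤ_) W≡0) (trans (ℤₚ.+-identityʳ (N size size)) (sym (Tcount-N size)))))) ,
    ℤₚ.+-injective (trans (ℤₚ.pos-* 2 (Tdet size -[1+ 0 ])) (trans (2Tdet₋ size)
      (trans (cong (N size size -ℤ_) W≡0) (trans (ℤₚ.+-identityʳ (N size size)) (sym (Tcount-N size))))))
    where
    size = suc (2 * q)
    W≡0 = W-odd-2* q 1≤q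

  even : (p : ℕ) → 1 ≤ p →
    (+ 2 *ℤ + Tdet (2 * p) (+ 1) ≡ + Tcount (2 * p) +ℤ sign p *ℤ + Tcount p)
    × (+ 2 *ℤ + Tdet (2 * p) -[1+ 0 ] ≡ + Tcount (2 * p) -ℤ sign p *ℤ + Tcount p)
  even p _ =
    trans (2Tdet₊ (2 * p)) (cong₂ _+ℤ_ (sym (Tcount-N (2 * p))) (W-even-2* p)) ,
    trans (2Tdet₋ (2 * p)) (cong₂ _-ℤ_ (sym (Tcount-N (2 * p))) (W-even-2* p))
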